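{- For all integers $n\geq 0$, $$B_{n}(y,t)=(1+yt)^{n}P_{n}^{(\mathrm{lpk},\mathrm{des})}\left(\frac{(1+y)^{2}t}{(y+t)(1+yt)},\frac{y+t}{1+yt}\right).$$ Equivalently, $$P_{n}^{(\mathrm{lpk},\mathrm{des})}(y,t)=\frac{B_{n}(u,v)}{(1+uv)^{n}},$$ where $$u=\frac{1+t^{2}-2yt-(1-t)\sqrt{(1+t)^{2}-4yt}}{2(1-y)t},\qquad v=\frac{(1+t)^{2}-2yt-(1+t)\sqrt{(1+t)^{2}-4yt}}{2yt}.$$
   Context: $\mathfrak{S}_n$ is the set of permutations $\pi=\pi_1\cdots\pi_n$ of $[n]=\{1,\dots,n\}$. For $\pi\in\mathfrak{S}_n$: $\mathrm{des}(\pi)$ is the number of $i\in[n-1]$ with $\pi_i>\pi_{i+1}$; $\mathrm{lpk}(\pi)$ is the number of left peaks, where $i\in[n-1]$ is a left peak if either $2\le i\le n-1$ and $\pi_{i-1}<\pi_i>\pi_{i+1}$, or $i=1$ and $\pi_1>\pi_2$. For $n\ge1$, $P_n^{(\mathrm{lpk},\mathrm{des})}(y,t)=\sum_{\pi\in\mathfrak{S}_n}y^{\mathrm{lpk}(\pi)}t^{\mathrm{des}(\pi)}$. $\mathfrak{B}_n$ is the set of signed permutations: permutations $\pi$ of $\{ -n,\dots,-1,0,1,\dots,n\}$ with $\pi_{ -i}=-\pi_i$ for all $i$ (so $\pi_0=0$), written $\pi=\pi_1\cdots\pi_n$. For $\pi\in\mathfrak{B}_n$, $\mathrm{des}_B(\pi)$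 is the number of $i\in\{0,1,\dots,n-1\}$ with $\pi_i>\pi_{i+1}$ (where $\pi_0=0$), and $\mathrm{neg}(\pi)$ is the number of $i\in[n]$ with $\pi_i<0$. For $n\ge1$, $B_n(y,t)=\sum_{\pi\in\mathfrak{B}_n}y^{\mathrm{neg}(\pi)}t^{\mathrm{des}_B(\pi)}$. The $0$th polynomials $P_0^{(\mathrm{lpk},\mathrm{des})}$ and $B_0$ are $1$. Here $y,t$ are indeterminates; the first identity is an identity of rational functions in $y,t$. In the second identity, $\sqrt{(1+t)^2-4yt}$ is the formal power series in $t$ over $\mathbb{Q}[y]$ with constant term $1$, so that $u$ and $v$ are formal power series in $t$ with coefficients in $\mathbb{Q}[y]$. -}

module Defs where

open import Level using (_⊔_; 0ℓ) renaming (suc to lsuc)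
open import Function.Base using (_∘_)
open import Data.Nat.Base as ℕ using (ℕ; zero; suc; z≤n; s≤s)
import Data.Nat.Properties as ℕ
open import Data.Integer.Base as ℤ using (ℤ; +_; 0ℤ)
import Data.Integer.Properties as ℤ
import Data.Rational.Base as ℚ
import Data.Rational.Properties as ℚ
open import Data.Bool.Base using (Bool; if_then_else_; _∧_)
open import Data.Product.Base using (_,_)
open import Data.List.Base
  using (List; []; _∷_; _++_; map; foldr; filter; length; reverse; upTo; cartesianProductWith)
open import Data.List.Relation.Unary.Unique.DecPropositional ℤ._≟_ using (unique?)
open import Relation.Nullary using (¬_; Stable)
open import Relation.Nullary.Decidable using (⌊_⌋; decidable-stable)
open import Relation.Binary.PropositionalEquality using (_≡_; refl; cong)
import Relation.Binary.PropositionalEquality as ≡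
open import Algebra.Bundles using (CommutativeRing; RawRing)
open import Algebra.Definitions using (AlmostLeftCancellative)
open import Algebra.Structures using (IsCommutativeRing)
import Algebra.Properties.Semiring.Exp as Exp
import Algebra.Properties.Ring as RingProperties
import Algebra.Properties.Group as GroupProperties
import Algebra.Morphism.RingMonomorphism as RingMonomorphism
import Algebra.Solver.Ring.NaturalCoefficients.Default as Solver
import Relation.Binary.Reasoning.Setoid as SetoidReasoning

-- Stability of equality is automatic classically; it lets "nonzero" be
-- the plain negation of "zero" throughout.
record IntegralDomain c ℓ : Set (lsuc (c ⊔ ℓ)) where
  field
    commutativeRing : CommutativeRing c ℓ
  open CommutativeRing commutativeRing public
  field
    ≈-stable  : ∀ {x y} → Stable (x ≈ y)
    1≉0       : ¬ 1# ≈ 0#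
    *-cancelˡ : AlmostLeftCancellative _≈_ 0# _*_

  open Exp semiring public using (_^_)

  *-≉0 : ∀ {x y} → ¬ x ≈ 0# → ¬ y ≈ 0# → ¬ x * y ≈ 0#
  *-≉0 {x} {y} x≉0 y≉0 xy≈0 =
    y≉0 (*-cancelˡ x y 0# x≉0 (trans xy≈0 (sym (zeroʳ x))))

  ^-≉0 : ∀ {x} → ¬ x ≈ 0# → ∀ n → ¬ x ^ n ≈ 0#
  ^-≉0 x≉0 zero    = 1≉0
  ^-≉0 x≉0 (suc n) = *-≉0 x≉0 (^-≉0 x≉0 n)

record Field c ℓ : Set (lsuc (c ⊔ ℓ)) where
  field
    integralDomain : IntegralDomain c ℓ
  open IntegralDomain integralDomain public
  field
    inverse   : (x : Carrier) → ¬ x ≈ 0# → Carrier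
    *-inverse : (x : Carrier) (x≉0 : ¬ x ≈ 0#) → x * inverse x x≉0 ≈ 1#

  infixl 7 _/_[_]
  _/_[_] : (x y : Carrier) → ¬ y ≈ 0# → Carrier
  x / y [ y≉0 ] = x * inverse y y≉0

module PowerSeries {c ℓ} (D : IntegralDomain c ℓ) where
  private
    module D = IntegralDomain D
    open Solver D.commutativeSemiring using (solve; _:=_; _:+_; _:*_)

  Series : Set c
  Series = ℕ → D.Carrier

  infix 4 _≈_
  record _≈_ (f g : Series) : Set ℓ where
    constructor coefficientwise
    field
      at : ∀ n → f n D.≈ g n
  open _≈_ public

  infixl 6 _+_
  _+_ : Series → Series → Series
  (f + g) n = f n D.+ g n

  -_ : Series → Series
  (- f) n = D.- f n

  -- (f * g) n = f 0 · g n + f 1 · g (n - 1) + ⋯ + f n · g 0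
  infixl 7 _*_
  _*_ : Series → Series → Series
  (f * g) zero    = f 0 D.* g 0
  (f * g) (suc n) = f 0 D.* g (suc n) D.+ ((f ∘ suc) * g) n

  constant : D.Carrier → Series
  constant a zero    = a
  constant a (suc _) = D.0#

  0# 1# : Series
  0# = λ _ → D.0#
  1# = constant D.1#

  X : Series
  X 1 = D.1#
  X _ = D.0#

  rawRing : RawRing c ℓ
  rawRing = record { _≈_ = _≈_ ; _+_ = _+_ ; _*_ = _*_ ; -_ = -_ ; 0# = 0# ; 1# = 1# }

  open SetoidReasoning D.setoid

  *-cong-upTo : ∀ n {f f′ g g′} →
    (∀ k → k ℕ.≤ n → f k D.≈ f′ k) → (∀ k → k ℕ.≤ n → g k D.≈ g′ k) →
    (f * g) n D.≈ (f′ * g′) n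
  *-cong-upTo zero    p q = D.*-cong (p 0 z≤n) (q 0 z≤n)
  *-cong-upTo (suc n) p q =
    D.+-cong (D.*-cong (p 0 z≤n) (q (suc n) ℕ.≤-refl))
             (*-cong-upTo n (λ k k≤n → p (suc k) (s≤s k≤n)) (λ k k≤n → q k (ℕ.m≤n⇒m≤1+n k≤n)))

  private
    *-congAt : ∀ n {f f′ g g′} → (∀ k → f k D.≈ f′ k) → (∀ k → g k D.≈ g′ k) →
               (f * g) n D.≈ (f′ * g′) n
    *-congAt n p q = *-cong-upTo n (λ k _ → p k) (λ k _ → q k)

  *-zeroˡ-at : ∀ n g → (0# * g) n D.≈ D.0#
  *-zeroˡ-at zero    g = D.zeroˡ _
  *-zeroˡ-at (suc n) g =
    D.trans (D.+-cong (D.zeroˡ _) (*-zeroˡ-at n g)) (D.+-identityˡ _)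

  *-snoc : ∀ n f g → (f * g) (suc n) D.≈ f (suc n) D.* g 0 D.+ (f * (g ∘ suc)) n
  *-snoc zero    f g = D.+-comm _ _
  *-snoc (suc n) f g = D.trans (D.+-congˡ (*-snoc n (f ∘ suc) g))
    (solve 3 (λ a b c → a :+ (b :+ c) := b :+ (a :+ c)) D.refl _ _ _)

  private
    *-comm-at : ∀ n f g → (f * g) n D.≈ (g * f) n
    *-comm-at zero    f g = D.*-comm _ _
    *-comm-at (suc n) f g = D.sym (D.trans (*-snoc n g f)
      (D.+-cong (D.*-comm _ _) (*-comm-at n g (f ∘ suc))))

    distribʳ-at : ∀ n f g h → ((g + h) * f) n D.≈ (g * f) n D.+ (h * f) n
    distribʳ-at zero    f g h = D.distribʳ _ _ _
    distribʳ-at (suc n) f g h =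
      D.trans (D.+-cong (D.distribʳ _ _ _) (distribʳ-at n f (g ∘ suc) (h ∘ suc)))
        (solve 4 (λ a b c d → (a :+ b) :+ (c :+ d) := (a :+ c) :+ (b :+ d)) D.refl _ _ _ _)

    scale-at : ∀ n a g h → ((λ k → a D.* g k) * h) n D.≈ a D.* (g * h) n
    scale-at zero    a g h = D.*-assoc _ _ _
    scale-at (suc n) a g h =
      D.trans (D.+-cong (D.*-assoc _ _ _) (scale-at n a (g ∘ suc) h)) (D.sym (D.distribˡ _ _ _))

    *-assoc-at : ∀ n f g h → ((f * g) * h) n D.≈ (f * (g * h)) n
    *-assoc-at zero    f g h = D.*-assoc _ _ _
    *-assoc-at (suc n) f g h = begin
      (f 0 D.* g 0) D.* h (suc n) D.+ (((λ k → f 0 D.* g (suc k)) + ((f ∘ suc) * g)) * h) n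
        ≈⟨ D.+-congˡ (distribʳ-at n h (λ k → f 0 D.* g (suc k)) ((f ∘ suc) * g)) ⟩
      (f 0 D.* g 0) D.* h (suc n) D.+
        (((λ k → f 0 D.* g (suc k)) * h) n D.+ (((f ∘ suc) * g) * h) n)
        ≈⟨ D.+-congˡ (D.+-cong (scale-at n (f 0) (g ∘ suc) h) (*-assoc-at n (f ∘ suc) g h)) ⟩
      (f 0 D.* g 0) D.* h (suc n) D.+
        (f 0 D.* ((g ∘ suc) * h) n D.+ ((f ∘ suc) * (g * h)) n)
        ≈⟨ solve 5 (λ a b c d e → (a :* b) :* c :+ (a :* d :+ e) := a :* (b :* c :+ d) :+ e)
             D.refl _ _ _ _ _ ⟩
      f 0 D.* (g 0 D.* h (suc n) D.+ ((g ∘ suc) * h) n) D.+ ((f ∘ suc) * (g * h)) n ∎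

    *-identityˡ-at : ∀ n f → (1# * f) n D.≈ f n
    *-identityˡ-at zero    f = D.*-identityˡ _
    *-identityˡ-at (suc n) f =
      D.trans (D.+-cong (D.*-identityˡ _) (*-zeroˡ-at n f)) (D.+-identityʳ _)

  isCommutativeRing : IsCommutativeRing _≈_ _+_ _*_ -_ 0# 1#
  isCommutativeRing = record
    { isRing = record
      { +-isAbelianGroup = record
        { isGroup = record
          { isMonoid = record
            { isSemigroup = record
              { isMagma = record
                { isEquivalence = record
                  { refl  = coefficientwise λ _ → D.refl
                  ; sym   = λ p → coefficientwise λ n → D.sym (at p n)
                  ; trans = λ p q → coefficientwise λ n → D.trans (at p n) (at q n)
                  }
                ; ∙-cong = λ p q → coefficientwise λ n → D.+-cong (at p n) (at q n)
                }
              ; assoc = λ _ _ _ → coefficientwise λ _ → D.+-assoc _ _ _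
              }
            ; identity = (λ _ → coefficientwise λ _ → D.+-identityˡ _)
                       , (λ _ → coefficientwise λ _ → D.+-identityʳ _)
            }
          ; inverse = (λ _ → coefficientwise λ _ → D.-‿inverseˡ _)
                    , (λ _ → coefficientwise λ _ → D.-‿inverseʳ _)
          ; ⁻¹-cong = λ p → coefficientwise λ n → D.-‿cong (at p n)
          }
        ; comm = λ _ _ → coefficientwise λ _ → D.+-comm _ _
        }
      ; *-cong = λ p q → coefficientwise λ n → *-congAt n (at p) (at q)
      ; *-assoc = λ f g h → coefficientwise λ n → *-assoc-at n f g h
      ; *-identity = (λ f → coefficientwise λ n → *-identityˡ-at n f)
                   , (λ f → coefficientwise λ n → D.trans (*-comm-at n f 1#) (*-identityˡ-at n f))
      ; distrib = (λ f g h → coefficientwise λ n → D.trans (*-comm-at n f (g + h))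
                     (D.trans (distribʳ-at n f g h)
                        (D.+-cong (*-comm-at n g f) (*-comm-at n h f))))
                , (λ f g h → coefficientwise λ n → distribʳ-at n f g h)
      }
    ; *-comm = λ f g → coefficientwise λ n → *-comm-at n f g
    }

  commutativeRing : CommutativeRing c ℓ
  commutativeRing = record { isCommutativeRing = isCommutativeRing }

  private
    module S = CommutativeRing commutativeRing

    ≈-stable : ∀ {f g} → Stable (f ≈ g)
    ≈-stable ¬¬f≈g = coefficientwise λ n → D.≈-stable λ ≉ → ¬¬f≈g λ f≈g → ≉ (at f≈g n)

    cancel0 : ∀ {a b} → ¬ a D.≈ D.0# → a D.* b D.≈ D.0# → b D.≈ D.0#
    cancel0 {a} {b} a≉0 ab≈0 = D.*-cancelˡ a b D.0# a≉0 (D.trans ab≈0 (D.sym (D.zeroʳ a)))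

    head≉0 : ∀ c → ¬ c 0 D.≈ D.0# → ∀ n d → (∀ k → (c * d) k D.≈ D.0#) → d n D.≈ D.0#
    head≉0 c c₀≉0 zero    d cd≈0 = cancel0 c₀≉0 (cd≈0 0)
    head≉0 c c₀≉0 (suc n) d cd≈0 = head≉0 c c₀≉0 n (d ∘ suc) λ k → begin
      (c * (d ∘ suc)) k                        ≈⟨ D.+-identityˡ _ ⟨
      D.0# D.+ (c * (d ∘ suc)) k               ≈⟨ D.+-congʳ (D.zeroʳ (c (suc k))) ⟨
      c (suc k) D.* D.0# D.+ (c * (d ∘ suc)) k ≈⟨ D.+-congʳ (D.*-congˡ (head≉0 c c₀≉0 zero d cd≈0)) ⟨
      c (suc k) D.* d 0 D.+ (c * (d ∘ suc)) k  ≈⟨ *-snoc k c d ⟨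
      (c * d) (suc k)                          ≈⟨ cd≈0 (suc k) ⟩
      D.0#                                     ∎

    coefficient≉0 : ∀ m c → ¬ c m D.≈ D.0# →
                    ∀ n d → (∀ k → (c * d) k D.≈ D.0#) → d n D.≈ D.0#
    coefficient≉0 zero    c c₀≉0 n d cd≈0 = head≉0 c c₀≉0 n d cd≈0
    coefficient≉0 (suc m) c cₘ≉0 n d cd≈0 = D.≈-stable λ dₙ≉0 →
      dₙ≉0 (head≉0 c (λ c₀≈0 → dₙ≉0 (coefficient≉0 m (c ∘ suc) cₘ≉0 n d λ k → begin
        ((c ∘ suc) * d) k                         ≈⟨ D.+-identityˡ _ ⟨
        D.0# D.+ ((c ∘ suc) * d) k                ≈⟨ D.+-congʳ (D.zeroˡ (d (suc k))) ⟨
        D.0# D.* d (suc k) D.+ ((c ∘ suc) * d) k  ≈⟨ D.+-congʳ (D.*-congʳ c₀≈0) ⟨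
        (c * d) (suc k)                           ≈⟨ cd≈0 (suc k) ⟩
        D.0#                                      ∎)) n d cd≈0)

    *-cancel0 : ∀ {c d} → ¬ c ≈ 0# → c * d ≈ 0# → d ≈ 0#
    *-cancel0 {c} {d} c≉0 cd≈0 = coefficientwise λ n → D.≈-stable λ dₙ≉0 →
      c≉0 (coefficientwise λ m → D.≈-stable λ cₘ≉0 → dₙ≉0 (coefficient≉0 m c cₘ≉0 n d (at cd≈0)))

    *-cancelˡ : AlmostLeftCancellative _≈_ 0# _*_
    *-cancelˡ c f g c≉0 cf≈cg = x∙y⁻¹≈ε⇒x≈y f g (*-cancel0 c≉0
      (S.trans (x[y-z]≈xy-xz c f g) (x≈y⇒x∙y⁻¹≈ε cf≈cg)))
      where
      open RingProperties S.ring using (x[y-z]≈xy-xz)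
      open GroupProperties S.+-group using (x∙y⁻¹≈ε⇒x≈y; x≈y⇒x∙y⁻¹≈ε)

  integralDomain : IntegralDomain c ℓ
  integralDomain = record
    { commutativeRing = commutativeRing
    ; ≈-stable        = ≈-stable
    ; 1≉0             = λ 1≈0 → D.1≉0 (at 1≈0 0)
    ; *-cancelˡ       = *-cancelˡ
    }

  -- The square root with constant term 1 of a series f with constant term 1.
  -- Its part e of positive degree is the solution of e = ½ (f - 1 - e²);
  -- approximation k is correct in degrees up to k.
  module SquareRoot (½ : D.Carrier) (½+½≈1 : ½ D.+ ½ D.≈ D.1#) where

    approximation : Series → ℕ → Series
    approximation f zero    = 0#
    approximation f (suc k) zero    = D.0#
    approximation f (suc k) (suc n) =
      ½ D.* (f (suc n) D.- (approximation f k * approximation f k) (suc n))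

    √ : Series → Series
    √ f n = (1# + approximation f n) n

    √-constantTerm : ∀ f → √ f 0 D.≈ D.1#
    √-constantTerm f = D.+-identityʳ _

    private
      square-cong : ∀ n {a b} → a 0 D.≈ D.0# → b 0 D.≈ D.0# →
        (∀ i → i ℕ.< n → a i D.≈ b i) → (a * a) n D.≈ (b * b) n
      square-cong zero a₀ b₀ _ =
        D.*-cong (D.trans a₀ (D.sym b₀)) (D.trans a₀ (D.sym b₀))
      square-cong (suc n) {a} {b} a₀ b₀ a≈b =
        D.trans (drop a a₀) (D.trans (tails n a≈b) (D.sym (drop b b₀)))
        where
        drop : ∀ c → c 0 D.≈ D.0# → (c * c) (suc n) D.≈ ((c ∘ suc) * c) n
        drop c c₀ = D.trans (D.+-congʳ (D.trans (D.*-congʳ c₀) (D.zeroˡ _))) (D.+-identityˡ _)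
        snoc : ∀ m c → c 0 D.≈ D.0# → ((c ∘ suc) * c) (suc m) D.≈ ((c ∘ suc) * (c ∘ suc)) m
        snoc m c c₀ = D.trans (*-snoc m (c ∘ suc) c)
          (D.trans (D.+-congʳ (D.trans (D.*-congˡ c₀) (D.zeroʳ _))) (D.+-identityˡ _))
        tails : ∀ m → (∀ i → i ℕ.< suc m → a i D.≈ b i) →
                ((a ∘ suc) * a) m D.≈ ((b ∘ suc) * b) m
        tails zero    _  = D.trans (D.*-congˡ a₀) (D.trans (D.zeroʳ _)
          (D.sym (D.trans (D.*-congˡ b₀) (D.zeroʳ _))))
        tails (suc m) eq = D.trans (snoc m a a₀)
          (D.trans (*-cong-upTo m (λ k k≤m → eq (suc k) (s≤s (s≤s k≤m)))
                                  (λ k k≤m → eq (suc k) (s≤s (s≤s k≤m))))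
                   (D.sym (snoc m b b₀)))

      approximation-0 : ∀ f k → approximation f k 0 D.≈ D.0#
      approximation-0 f zero    = D.refl
      approximation-0 f (suc k) = D.refl

      approximation-step : ∀ f k i → i ℕ.≤ k → approximation f k i D.≈ approximation f (suc k) i
      approximation-step f k       zero    _         = approximation-0 f k
      approximation-step f (suc k) (suc i) (s≤s i≤k) =
        D.*-congˡ (D.+-congˡ (D.-‿cong (square-cong (suc i) (approximation-0 f k) D.refl
          (λ j j≤i → approximation-step f k j (ℕ.≤-trans (ℕ.≤-pred j≤i) i≤k)))))

      approximation-stable : ∀ f {k i} → i ℕ.≤′ k → approximation f i i D.≈ approximation f k i
      approximation-stable f (ℕ.≤′-reflexive refl) = D.refl
      approximation-stable f (ℕ.≤′-step i≤k) =
        D.trans (approximation-stable f i≤k) (approximation-step f _ _ (ℕ.≤′⇒≤ i≤k))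

    √-square : ∀ f → f 0 D.≈ D.1# → √ f * √ f ≈ f
    √-square f f₀≈1 = S.trans expand (coefficientwise go)
      where
      e : Series
      e n = approximation f n n
      open Solver S.commutativeSemiring using ()
        renaming (solve to solveˢ; _:=_ to _≔_; _:+_ to _⊕_)
      expand : √ f * √ f ≈ 1# + ((e + e) + e * e)
      expand = S.trans (S.*-cong √f √f)
        (S.trans (S.distribˡ (1# + e) 1# e)
          (S.trans (S.+-cong (S.*-identityʳ _) (S.trans (S.distribʳ e 1# e)
              (S.+-congʳ (S.*-identityˡ e))))
            (solveˢ 3 (λ o a b → (o ⊕ a) ⊕ (a ⊕ b) ≔ o ⊕ ((a ⊕ a) ⊕ b)) S.refl 1# e (e * e))))
        where
        √f : √ f ≈ 1# + e
        √f = coefficientwise λ _ → D.refl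
      go : ∀ n → (1# + ((e + e) + e * e)) n D.≈ f n
      go zero = begin
        D.1# D.+ ((D.0# D.+ D.0#) D.+ D.0# D.* D.0#)
          ≈⟨ D.+-congˡ (D.+-cong (D.+-identityˡ _) (D.zeroˡ _)) ⟩
        D.1# D.+ (D.0# D.+ D.0#) ≈⟨ D.+-congˡ (D.+-identityˡ _) ⟩
        D.1# D.+ D.0#            ≈⟨ D.+-identityʳ _ ⟩
        D.1#                     ≈⟨ f₀≈1 ⟨
        f 0                      ∎
      go (suc n) = begin
        D.0# D.+ ((½ D.* d D.+ ½ D.* d) D.+ (e * e) (suc n)) ≈⟨ D.+-identityˡ _ ⟩
        (½ D.* d D.+ ½ D.* d) D.+ (e * e) (suc n)            ≈⟨ D.+-congʳ (D.distribʳ d ½ ½) ⟨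
        (½ D.+ ½) D.* d D.+ (e * e) (suc n)                  ≈⟨ D.+-congʳ (D.*-congʳ ½+½≈1) ⟩
        D.1# D.* d D.+ (e * e) (suc n)                       ≈⟨ D.+-congʳ (D.*-identityˡ d) ⟩
        d D.+ (e * e) (suc n)
          ≈⟨ D.+-congˡ (square-cong (suc n) D.refl (approximation-0 f n)
               (λ i i≤n → approximation-stable f (ℕ.≤⇒≤′ (ℕ.≤-pred i≤n)))) ⟩
        (f (suc n) D.- s) D.+ s                              ≈⟨ D.+-assoc _ _ _ ⟩
        f (suc n) D.+ (D.- s D.+ s)                          ≈⟨ D.+-congˡ (D.-‿inverseˡ s) ⟩
        f (suc n) D.+ D.0#                                   ≈⟨ D.+-identityʳ _ ⟩
        f (suc n)                                            ∎
        where
        s d : D.Carrier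
        s = (approximation f n * approximation f n) (suc n)
        d = f (suc n) D.- s

-- A polynomial is a power series with finitely many nonzero coefficients.
module Polynomial {c ℓ} (D : IntegralDomain c ℓ) where
  private
    module D = IntegralDomain D
    module S = PowerSeries D
    module Sᴿ = IntegralDomain S.integralDomain

  record Poly : Set (c ⊔ ℓ) where
    no-eta-equality
    field
      coefficient : ℕ → D.Carrier
      bound       : ℕ
      vanishing   : ∀ n → bound ℕ.≤ n → coefficient n D.≈ D.0#
  open Poly public

  infix 4 _≈_
  record _≈_ (p q : Poly) : Set ℓ where
    constructor series
    field
      ≈-series : coefficient p S.≈ coefficient q
  open _≈_ public

  private
    *-vanishing : ∀ b b′ {f g} → (∀ n → b ℕ.≤ n → f n D.≈ D.0#) →
      (∀ n → b′ ℕ.≤ n → g n D.≈ D.0#) → ∀ n → b ℕ.+ b′ ℕ.≤ n → (f S.* g) n D.≈ D.0#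
    *-vanishing zero b′ {f} {g} p q n _ =
      D.trans (S.*-cong-upTo n {g′ = g} (λ k _ → p k z≤n) (λ _ _ → D.refl)) (S.*-zeroˡ-at n g)
    *-vanishing (suc b) b′ p q (suc n) (s≤s b+b′≤n) = D.trans
      (D.+-cong
        (D.trans (D.*-congˡ (q (suc n) (ℕ.m≤n⇒m≤1+n (ℕ.≤-trans (ℕ.m≤n+m b′ b) b+b′≤n)))) (D.zeroʳ _))
        (*-vanishing b b′ (λ k b≤k → p (suc k) (s≤s b≤k)) q n b+b′≤n))
      (D.+-identityˡ _)

  infixl 6 _+_
  _+_ : Poly → Poly → Poly
  coefficient (p + q) = coefficient p S.+ coefficient q
  bound       (p + q) = bound p ℕ.⊔ bound q
  vanishing   (p + q) n b⊔b′≤n = D.trans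
    (D.+-cong (vanishing p n (ℕ.m⊔n≤o⇒m≤o (bound p) (bound q) b⊔b′≤n))
              (vanishing q n (ℕ.m⊔n≤o⇒n≤o (bound p) (bound q) b⊔b′≤n)))
    (D.+-identityˡ _)

  infixl 7 _*_
  _*_ : Poly → Poly → Poly
  coefficient (p * q) = coefficient p S.* coefficient q
  bound       (p * q) = bound p ℕ.+ bound q
  vanishing   (p * q) = *-vanishing (bound p) (bound q) (vanishing p) (vanishing q)

  -_ : Poly → Poly
  coefficient (- p)       = S.- coefficient p
  bound       (- p)       = bound p
  vanishing   (- p) n b≤n = D.trans (D.-‿cong (vanishing p n b≤n)) ε⁻¹≈ε
    where open GroupProperties D.+-group using (ε⁻¹≈ε)

  constant : D.Carrier → Poly
  coefficient (constant a)           = S.constant a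
  bound       (constant a)           = 1
  vanishing   (constant a) (suc _) _ = D.refl

  0# 1# X : Poly
  coefficient 0#     = S.0#
  bound       0#     = 0
  vanishing   0# _ _ = D.refl
  1# = constant D.1#
  coefficient X                       = S.X
  bound       X                       = 2
  vanishing   X (suc (suc _)) _       = D.refl
  vanishing   X (suc zero)    (s≤s ())

  rawRing : RawRing (c ⊔ ℓ) ℓ
  rawRing = record { _≈_ = _≈_ ; _+_ = _+_ ; _*_ = _*_ ; -_ = -_ ; 0# = 0# ; 1# = 1# }

  commutativeRing : CommutativeRing (c ⊔ ℓ) ℓ
  commutativeRing = record
    { isCommutativeRing = RingMonomorphism.isCommutativeRing {R₁ = rawRing} {R₂ = S.rawRing}
        {⟦_⟧ = coefficient}
        (record
          { isRingHomomorphism = record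
            { isSemiringHomomorphism = record
              { isNearSemiringHomomorphism = record
                { +-isMonoidHomomorphism = record
                  { isMagmaHomomorphism = record
                    { isRelHomomorphism = record { cong = ≈-series }
                    ; homo = λ _ _ → Sᴿ.refl
                    }
                  ; ε-homo = Sᴿ.refl
                  }
                ; *-homo = λ _ _ → Sᴿ.refl
                }
              ; 1#-homo = Sᴿ.refl
              }
            ; -‿homo = λ _ → Sᴿ.refl
            }
          ; injective = series
          })
        S.isCommutativeRing
    }

  integralDomain : IntegralDomain (c ⊔ ℓ) ℓ
  integralDomain = record
    { commutativeRing = commutativeRing
    ; ≈-stable        = λ ¬¬p≈q → series (Sᴿ.≈-stable λ ≉ → ¬¬p≈q λ p≈q → ≉ (≈-series p≈q))
    ; 1≉0             = λ 1≈0 → Sᴿ.1≉0 (≈-series 1≈0)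
    ; *-cancelˡ       = λ p q r p≉0 pq≈pr →
        series (Sᴿ.*-cancelˡ _ _ _ (λ p≈0 → p≉0 (series p≈0)) (≈-series pq≈pr))
    }

module FractionField {c ℓ} (D : IntegralDomain c ℓ) where
  private
    module D = IntegralDomain D
    open Solver D.commutativeSemiring using (solve; _:=_; _:+_; _:*_)
    open SetoidReasoning D.setoid

  record Fraction : Set (c ⊔ ℓ) where
    no-eta-equality
    field
      numerator     : D.Carrier
      denominator   : D.Carrier
      denominator≉0 : ¬ denominator D.≈ D.0#
  open Fraction public

  infix 4 _≈_
  record _≈_ (x y : Fraction) : Set ℓ where
    constructor crossMultiplied
    field
      cross : numerator x D.* denominator y D.≈ numerator y D.* denominator x
  open _≈_ public

  infixl 6 _+_
  _+_ : Fraction → Fraction → Fraction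
  numerator     (x + y) = numerator x D.* denominator y D.+ numerator y D.* denominator x
  denominator   (x + y) = denominator x D.* denominator y
  denominator≉0 (x + y) = D.*-≉0 (denominator≉0 x) (denominator≉0 y)

  infixl 7 _*_
  _*_ : Fraction → Fraction → Fraction
  numerator     (x * y) = numerator x D.* numerator y
  denominator   (x * y) = denominator x D.* denominator y
  denominator≉0 (x * y) = D.*-≉0 (denominator≉0 x) (denominator≉0 y)

  -_ : Fraction → Fraction
  numerator     (- x) = D.- numerator x
  denominator   (- x) = denominator x
  denominator≉0 (- x) = denominator≉0 x

  ι : D.Carrier → Fraction
  numerator     (ι a) = a
  denominator   (ι a) = D.1#
  denominator≉0 (ι a) = D.1≉0

  0# 1# : Fraction
  0# = ι D.0#
  1# = ι D.1#

  private
    open RingProperties D.ring using (-‿distribˡ-*)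

    ≈-refl : ∀ {x} → x ≈ x
    ≈-refl = crossMultiplied D.refl

    ≈-sym : ∀ {x y} → x ≈ y → y ≈ x
    ≈-sym p = crossMultiplied (D.sym (cross p))

    ≈-trans : ∀ {x y z} → x ≈ y → y ≈ z → x ≈ z
    ≈-trans {x} {y} {z} p q =
      let a = numerator x; b = denominator x; c = numerator y; d = denominator y
          e = numerator z; f = denominator z in
      crossMultiplied (D.*-cancelˡ d _ _ (denominator≉0 y) (begin
        d D.* (a D.* f) ≈⟨ solve 3 (λ d a f → d :* (a :* f) := (a :* d) :* f) D.refl d a f ⟩
        (a D.* d) D.* f ≈⟨ D.*-congʳ (cross p) ⟩
        (c D.* b) D.* f ≈⟨ solve 3 (λ c b f → (c :* b) :* f := (c :* f) :* b) D.refl c b f ⟩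
        (c D.* f) D.* b ≈⟨ D.*-congʳ (cross q) ⟩
        (e D.* d) D.* b ≈⟨ solve 3 (λ e d b → (e :* d) :* b := d :* (e :* b)) D.refl e d b ⟩
        d D.* (e D.* b) ∎))

    +-cong : ∀ {x x′ y y′} → x ≈ x′ → y ≈ y′ → x + y ≈ x′ + y′
    +-cong {x} {x′} {y} {y′} p q =
      let a = numerator x; b = denominator x; a′ = numerator x′; b′ = denominator x′
          c = numerator y; d = denominator y; c′ = numerator y′; d′ = denominator y′ in
      crossMultiplied (begin
        (a D.* d D.+ c D.* b) D.* (b′ D.* d′)
          ≈⟨ solve 6 (λ a b c d b′ d′ → (a :* d :+ c :* b) :* (b′ :* d′) :=
               (a :* b′) :* (d :* d′) :+ (c :* d′) :* (b :* b′)) D.refl a b c d b′ d′ ⟩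
        (a D.* b′) D.* (d D.* d′) D.+ (c D.* d′) D.* (b D.* b′)
          ≈⟨ D.+-cong (D.*-congʳ (cross p)) (D.*-congʳ (cross q)) ⟩
        (a′ D.* b) D.* (d D.* d′) D.+ (c′ D.* d) D.* (b D.* b′)
          ≈⟨ solve 6 (λ a′ b c′ d b′ d′ → (a′ :* b) :* (d :* d′) :+ (c′ :* d) :* (b :* b′) :=
               (a′ :* d′ :+ c′ :* b′) :* (b :* d)) D.refl a′ b c′ d b′ d′ ⟩
        (a′ D.* d′ D.+ c′ D.* b′) D.* (b D.* d) ∎)

    *-cong : ∀ {x x′ y y′} → x ≈ x′ → y ≈ y′ → x * y ≈ x′ * y′
    *-cong {x} {x′} {y} {y′} p q =
      let a = numerator x; b = denominator x; a′ = numerator x′; b′ = denominator x′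
          c = numerator y; d = denominator y; c′ = numerator y′; d′ = denominator y′ in
      crossMultiplied (begin
        (a D.* c) D.* (b′ D.* d′)
          ≈⟨ solve 4 (λ a c b′ d′ → (a :* c) :* (b′ :* d′) := (a :* b′) :* (c :* d′))
               D.refl a c b′ d′ ⟩
        (a D.* b′) D.* (c D.* d′) ≈⟨ D.*-cong (cross p) (cross q) ⟩
        (a′ D.* b) D.* (c′ D.* d)
          ≈⟨ solve 4 (λ a′ b c′ d → (a′ :* b) :* (c′ :* d) := (a′ :* c′) :* (b :* d))
               D.refl a′ b c′ d ⟩
        (a′ D.* c′) D.* (b D.* d) ∎)

    -‿cong : ∀ {x y} → x ≈ y → - x ≈ - y
    -‿cong p = crossMultiplied (D.trans (D.sym (-‿distribˡ-* _ _))
      (D.trans (D.-‿cong (cross p)) (-‿distribˡ-* _ _)))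

    +-assoc : ∀ x y z → (x + y) + z ≈ x + (y + z)
    +-assoc x y z = crossMultiplied
      (solve 6 (λ a b c d e f →
         ((a :* d :+ c :* b) :* f :+ e :* (b :* d)) :* (b :* (d :* f)) :=
         (a :* (d :* f) :+ (c :* f :+ e :* d) :* b) :* ((b :* d) :* f)) D.refl
         (numerator x) (denominator x) (numerator y) (denominator y) (numerator z) (denominator z))

    +-comm : ∀ x y → x + y ≈ y + x
    +-comm x y = crossMultiplied
      (solve 4 (λ a b c d → (a :* d :+ c :* b) :* (d :* b) := (c :* b :+ a :* d) :* (b :* d))
         D.refl
         (numerator x) (denominator x) (numerator y) (denominator y))

    +-identityˡ : ∀ x → 0# + x ≈ x
    +-identityˡ x = crossMultiplied (D.*-cong
      (D.trans (D.+-cong (D.zeroˡ _) (D.*-identityʳ _)) (D.+-identityˡ _))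
      (D.sym (D.*-identityˡ _)))

    -‿inverseˡ : ∀ x → - x + x ≈ 0#
    -‿inverseˡ x = crossMultiplied (D.trans
      (D.trans (D.*-congʳ (D.trans (D.sym (D.distribʳ _ _ _))
        (D.trans (D.*-congʳ (D.-‿inverseˡ _)) (D.zeroˡ _)))) (D.zeroˡ _))
      (D.sym (D.zeroˡ _)))

    *-assoc : ∀ x y z → (x * y) * z ≈ x * (y * z)
    *-assoc x y z = crossMultiplied
      (solve 6 (λ a b c d e f → ((a :* c) :* e) :* (b :* (d :* f)) :=
         (a :* (c :* e)) :* ((b :* d) :* f)) D.refl
         (numerator x) (denominator x) (numerator y) (denominator y) (numerator z) (denominator z))

    *-comm : ∀ x y → x * y ≈ y * x
    *-comm x y = crossMultiplied
      (solve 4 (λ a b c d → (a :* c) :* (d :* b) := (c :* a) :* (b :* d)) D.refl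
         (numerator x) (denominator x) (numerator y) (denominator y))

    *-identityˡ : ∀ x → 1# * x ≈ x
    *-identityˡ x =
      crossMultiplied (D.*-cong (D.*-identityˡ _) (D.sym (D.*-identityˡ _)))

    distribʳ : ∀ x y z → (y + z) * x ≈ y * x + z * x
    distribʳ x y z = crossMultiplied
      (solve 6 (λ a b c d e f →
         ((c :* f :+ e :* d) :* a) :* ((d :* b) :* (f :* b)) :=
         ((c :* a) :* (f :* b) :+ (e :* a) :* (d :* b)) :* ((d :* f) :* b)) D.refl
         (numerator x) (denominator x) (numerator y) (denominator y) (numerator z) (denominator z))

  isCommutativeRing : IsCommutativeRing _≈_ _+_ _*_ -_ 0# 1#
  isCommutativeRing = record
    { isRing = record
      { +-isAbelianGroup = record
        { isGroup = record
          { isMonoid = record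
            { isSemigroup = record
              { isMagma = record
                { isEquivalence = record { refl = ≈-refl ; sym = ≈-sym ; trans = ≈-trans }
                ; ∙-cong = +-cong
                }
              ; assoc = +-assoc
              }
            ; identity = +-identityˡ , λ x → ≈-trans (+-comm x 0#) (+-identityˡ x)
            }
          ; inverse = -‿inverseˡ , λ x → ≈-trans (+-comm x (- x)) (-‿inverseˡ x)
          ; ⁻¹-cong = -‿cong
          }
        ; comm = +-comm
        }
      ; *-cong = *-cong
      ; *-assoc = *-assoc
      ; *-identity = *-identityˡ , λ x → ≈-trans (*-comm x 1#) (*-identityˡ x)
      ; distrib = (λ x y z → ≈-trans (*-comm x (y + z))
                     (≈-trans (distribʳ x y z) (+-cong (*-comm y x) (*-comm z x))))
                , distribʳ
      }
    ; *-comm = *-comm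
    }

  commutativeRing : CommutativeRing (c ⊔ ℓ) ℓ
  commutativeRing = record { isCommutativeRing = isCommutativeRing }

  ι-injective : ∀ {a b} → ι a ≈ ι b → a D.≈ b
  ι-injective p = D.trans (D.sym (D.*-identityʳ _)) (D.trans (cross p) (D.*-identityʳ _))

  numerator≉0 : ∀ {x} → ¬ x ≈ 0# → ¬ numerator x D.≈ D.0#
  numerator≉0 x≉0 a≈0 = x≉0 (crossMultiplied
    (D.trans (D.*-congʳ a≈0) (D.trans (D.zeroˡ _) (D.sym (D.zeroˡ _)))))

  inverse : (x : Fraction) → ¬ x ≈ 0# → Fraction
  numerator     (inverse x x≉0) = denominator x
  denominator   (inverse x x≉0) = numerator x
  denominator≉0 (inverse x x≉0) = numerator≉0 x≉0

  private
    *-inverse : (x : Fraction) (x≉0 : ¬ x ≈ 0#) → x * inverse x x≉0 ≈ 1#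
    *-inverse x _ = crossMultiplied (D.trans (D.*-identityʳ _)
      (D.trans (D.*-comm _ _) (D.sym (D.*-identityˡ _))))

    *-cancelˡ : AlmostLeftCancellative _≈_ 0# _*_
    *-cancelˡ x y z x≉0 xy≈xz = ≈-trans (≈-sym (undo y))
      (≈-trans (*-cong (≈-refl {inverse x x≉0}) xy≈xz) (undo z))
      where
      undo : ∀ w → inverse x x≉0 * (x * w) ≈ w
      undo w = ≈-trans (≈-sym (*-assoc (inverse x x≉0) x w))
        (≈-trans (*-cong (≈-trans (*-comm (inverse x x≉0) x) (*-inverse x x≉0)) (≈-refl {w}))
                 (*-identityˡ w))

  fractionField : Field (c ⊔ ℓ) ℓ
  fractionField = record
    { integralDomain = record
      { commutativeRing = commutativeRing
      ; ≈-stable        = λ ¬¬x≈y → crossMultiplied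
          (D.≈-stable λ ≉ → ¬¬x≈y λ x≈y → ≉ (cross x≈y))
      ; 1≉0             = λ 1≈0 → D.1≉0 (ι-injective 1≈0)
      ; *-cancelˡ       = *-cancelˡ
      }
    ; inverse   = inverse
    ; *-inverse = *-inverse
    }

words : List ℤ → ℕ → List (List ℤ)
words letters zero    = [] ∷ []
words letters (suc n) = cartesianProductWith _∷_ letters (words letters n)

-- π₁ ⋯ πₙ over {1, …, n} with pairwise distinct letters
𝔖 : ℕ → List (List ℤ)
𝔖 n = filter unique? (words (map (λ k → + suc k) (upTo n)) n)

-- π₋ₙ ⋯ π₋₁ π₀ π₁ ⋯ πₙ, where π₋ᵢ = - πᵢ
oddExtension : List ℤ → List ℤ
oddExtension w = map ℤ.-_ (reverse w) ++ 0ℤ ∷ w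

-- π₁ ⋯ πₙ over {-n, …, n} whose odd extension is a permutation of {-n, …, n}
𝔅 : ℕ → List (List ℤ)
𝔅 n = filter (unique? ∘ oddExtension)
             (words (map (λ k → + k ℤ.- + n) (upTo (suc (2 ℕ.* n)))) n)

infix 4 _<ᵇ_
_<ᵇ_ : ℤ → ℤ → Bool
a <ᵇ b = ⌊ a ℤ.<? b ⌋

indicator : Bool → ℕ
indicator b = if b then 1 else 0

des : List ℤ → ℕ
des (a ∷ b ∷ w) = indicator (b <ᵇ a) ℕ.+ des (b ∷ w)
des _           = 0

interiorPeaks : List ℤ → ℕ
interiorPeaks (a ∷ b ∷ c ∷ w) = indicator ((a <ᵇ b) ∧ (c <ᵇ b)) ℕ.+ interiorPeaks (b ∷ c ∷ w)
interiorPeaks _               = 0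

lpk : List ℤ → ℕ
lpk (a ∷ b ∷ w) = indicator (b <ᵇ a) ℕ.+ interiorPeaks (a ∷ b ∷ w)
lpk _           = 0

des-B : List ℤ → ℕ
des-B w = des (0ℤ ∷ w)

neg : List ℤ → ℕ
neg w = length (filter (ℤ._<? 0ℤ) w)

-- The polynomials, evaluated at elements y and t of a commutative ring.  Since
-- 𝔖 0 and 𝔅 0 consist of the empty word alone, both are 1 for n = 0.
module _ {c ℓ} (R : CommutativeRing c ℓ) where
  open CommutativeRing R
  open Exp semiring using (_^_)

  P⟨lpk,des⟩ : ℕ → Carrier → Carrier → Carrier
  P⟨lpk,des⟩ n y t = foldr _+_ 0# (map (λ π → y ^ lpk π * t ^ des π) (𝔖 n))

  B : ℕ → Carrier → Carrier → Carrier
  B n y t = foldr _+_ 0# (map (λ π → y ^ neg π * t ^ des-B π) (𝔅 n))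

ℚ-integralDomain : IntegralDomain 0ℓ 0ℓ
ℚ-integralDomain = record
  { commutativeRing = ℚ.+-*-commutativeRing
  ; ≈-stable        = λ {p} {q} → decidable-stable (p ℚ.≟ q)
  ; 1≉0             = λ ()
  ; *-cancelˡ       = λ p q r p≢0 → ℚ-cancelˡ p q r p≢0
  }
  where
  ℚ-cancelˡ : AlmostLeftCancellative _≡_ ℚ.0ℚ ℚ._*_
  ℚ-cancelˡ p q r p≢0 pq≡pr = ≡.trans (≡.sym (undo q)) (≡.trans (cong (ℚ.1/ p ℚ.*_) pq≡pr) (undo r))
    where
    instance
      p-nonZero : ℚ.NonZero p
      p-nonZero = ℚ.≢-nonZero p≢0
    undo : ∀ s → ℚ.1/ p ℚ.* (p ℚ.* s) ≡ s
    undo s = ≡.trans (≡.sym (ℚ.*-assoc (ℚ.1/ p) p s))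
      (≡.trans (cong (ℚ._* s) (ℚ.*-inverseˡ p)) (ℚ.*-identityˡ s))

module ℚ⟦y⟧     = PowerSeries ℚ-integralDomain
module ℚ[y]     = Polynomial ℚ-integralDomain
module ℚ[y,t]   = Polynomial ℚ[y].integralDomain
module ℚ⟨y,t⟩   = FractionField ℚ[y,t].integralDomain
module ℚ[y]⟦t⟧  = PowerSeries ℚ[y].integralDomain
module Frac-ℚ[y]⟦t⟧ = FractionField ℚ[y]⟦t⟧.integralDomain

module RationalFunctions where
  open Field ℚ⟨y,t⟩.fractionField public

  y t : Carrier
  y = ℚ⟨y,t⟩.ι (ℚ[y,t].constant ℚ[y].X)
  t = ℚ⟨y,t⟩.ι ℚ[y,t].X

  1+yt≉0 : ¬ 1# + y * t ≈ 0#
  1+yt≉0 p with () ← ℚ⟦y⟧.at (ℚ[y].≈-series (ℚ[y]⟦t⟧.at (ℚ[y,t].≈-series (ℚ⟨y,t⟩.cross p)) 0)) 0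

  y+t≉0 : ¬ y + t ≈ 0#
  y+t≉0 p with () ← ℚ⟦y⟧.at (ℚ[y].≈-series (ℚ[y]⟦t⟧.at (ℚ[y,t].≈-series (ℚ⟨y,t⟩.cross p)) 0)) 1

  [y+t][1+yt]≉0 : ¬ (y + t) * (1# + y * t) ≈ 0#
  [y+t][1+yt]≉0 = *-≉0 y+t≉0 1+yt≉0

module PowerSeriesInT where
  open IntegralDomain ℚ[y]⟦t⟧.integralDomain public

  y t : Carrier
  y = ℚ[y]⟦t⟧.constant ℚ[y].X
  t = ℚ[y]⟦t⟧.X

  2# : Carrier
  2# = 1# + 1#

  private
    module ℚ[y]ᴿ = IntegralDomain ℚ[y].integralDomain

    ½+½≈1 : ℚ[y].constant ℚ.½ ℚ[y]ᴿ.+ ℚ[y].constant ℚ.½ ℚ[y]ᴿ.≈ ℚ[y]ᴿ.1#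
    ½+½≈1 = ℚ[y].series (ℚ⟦y⟧.coefficientwise λ { zero → ≡.refl ; (suc _) → ≡.refl })

  open ℚ[y]⟦t⟧.SquareRoot (ℚ[y].constant ℚ.½) ½+½≈1 public

  ρ : Carrier
  ρ = √ ((1# + t) ^ 2 - 2# * 2# * y * t)

  ρ-constantTerm : ρ 0 ℚ[y]ᴿ.≈ ℚ[y]ᴿ.1#
  ρ-constantTerm = √-constantTerm ((1# + t) ^ 2 - 2# * 2# * y * t)

  ρ-square : ρ * ρ ≈ (1# + t) ^ 2 - 2# * 2# * y * t
  ρ-square = √-square _ constantTerm
    where
    module R = ℚ[y]ᴿ
    open GroupProperties R.+-group using (ε⁻¹≈ε)
    1+0≈1 : R.1# R.+ R.0# R.≈ R.1#
    1+0≈1 = R.+-identityʳ R.1#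
    constantTerm : ((1# + t) ^ 2 - 2# * 2# * y * t) 0 R.≈ R.1#
    constantTerm = R.trans
      (R.+-cong
        (R.trans (R.*-cong 1+0≈1 (R.trans (R.*-identityʳ _) 1+0≈1)) (R.*-identityˡ _))
        (R.trans (R.-‿cong (R.zeroʳ ((2# * 2# * y) 0))) ε⁻¹≈ε))
      1+0≈1

  2[1-y]t≉0 : ¬ 2# * (1# - y) * t ≈ 0#
  2[1-y]t≉0 p with () ← ℚ⟦y⟧.at (ℚ[y].≈-series (ℚ[y]⟦t⟧.at p 1)) 0

  2yt≉0 : ¬ 2# * y * t ≈ 0#
  2yt≉0 p with () ← ℚ⟦y⟧.at (ℚ[y].≈-series (ℚ[y]⟦t⟧.at p 1)) 1

module QuotientsOfPowerSeries = Field Frac-ℚ[y]⟦t⟧.fractionField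

module Substitution where
  private
    module F = QuotientsOfPowerSeries
  open PowerSeriesInT
  open Frac-ℚ[y]⟦t⟧ using (ι; ι-injective)

  ι-≉0 : ∀ {a} → ¬ a ≈ 0# → ¬ ι a F.≈ F.0#
  ι-≉0 {a} a≉0 ιa≈0 = a≉0 (ι-injective {a} {0#} ιa≈0)

  -- The quotients are formed in the fraction field of ℚ[y]⟦t⟧, of which
  -- ℚ[y]⟦t⟧ is a subring via ι.
  u v : F.Carrier
  u = ι (1# + t ^ 2 - 2# * y * t - (1# - t) * ρ)   F./ ι (2# * (1# - y) * t) [ ι-≉0 2[1-y]t≉0 ]
  v = ι ((1# + t) ^ 2 - 2# * y * t - (1# + t) * ρ) F./ ι (2# * y * t) [ ι-≉0 2yt≉0 ]

  1+uv≉0 : ¬ F.1# F.+ u F.* v F.≈ F.0#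
  1+uv≉0 p with () ← ℚ⟦y⟧.at (ℚ[y].≈-series (ℚ[y]⟦t⟧.at (Frac-ℚ[y]⟦t⟧.cross p) 2)) 1

-- Build signed permutations by inserting ± (n + 1) into those of size n, and permutations by
-- inserting n + 1.  Weight each ascent of 0 π₁ ⋯ πₙ by 𝐚, each descent by 𝐝 and each negative letter
-- by 𝐲.  Inserting ± (n + 1) into a slot between two letters replaces 𝐚 or 𝐝 by (1 + 𝐲) 𝐚 𝐝, and
-- appending it multiplies the weight by 𝐚 + 𝐲 𝐝, so the sum over 𝔅 (n + 1) is T applied to the sum
-- over 𝔅 n, where T f = D f + f (𝐚 + 𝐲 𝐝) and D is the derivation with D 𝐚 = D 𝐝 = (1 + 𝐲) 𝐚 𝐝 and
-- D 𝐲 = 0.  For permutations, weight each peak (its ascent and its descent together) by p, every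
-- other ascent by α and every other descent by δ.  Inserting n + 1 replaces α or δ by p, replaces p
-- by p (α + δ), and appending it multiplies by α.  This is again T once α = 𝐚 + 𝐲 𝐝, δ = 𝐝 + 𝐲 𝐚 and
-- p = (1 + 𝐲)² 𝐚 𝐝, so the two sums agree for every n; put 𝐚 = 1 and 𝐝 = t.  For the converse, u and v
-- solve t (1 + u v) = u + v and y (u + v) (1 + u v) = (1 + u)² v.

module Submission where

open import Algebra.Bundles using (CommutativeRing; CommutativeSemiring)
import Algebra.Properties.AbelianGroup as AbelianGroupProperties
import Algebra.Properties.Group as GroupProperties
import Algebra.Properties.Semiring.Exp as Exp
import Algebra.Solver.Ring.NaturalCoefficients.Default as Solver
open import Algebra.Structures.Biased using (isCommutativeSemiringˡ)
open import Data.Bool.Base using (true; false; if_then_else_)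
open import Data.Empty using (⊥)
open import Data.Integer.Base as ℤ using (ℤ; +_; -[1+_]; 0ℤ; ∣_∣)
import Data.Integer.Properties as ℤ
open import Data.List.Base
  using (List; []; _∷_; _++_; map; foldr; concatMap; length; upTo)
open import Data.List.Membership.Propositional using (_∈_; find; lose)
open import Data.List.Membership.Propositional.Properties
open import Data.List.Membership.Propositional.Properties.WithK using (unique∧set⇒bag)
open import Data.List.Properties using (∷-injective)
open import Data.List.Relation.Binary.BagAndSetEquality using (∼bag⇒↭)
open import Data.List.Relation.Binary.Permutation.Propositional as ↭ using (_↭_; ↭-sym; ↭⇒↭ₛ)
import Data.List.Relation.Binary.Permutation.Propositional.Properties as ↭
import Data.List.Relation.Binary.Permutation.Setoid.Properties as ↭ₛ
open import Data.List.Relation.Unary.All as All using (All; []; _∷_)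
import Data.List.Relation.Unary.All.Properties as All
open import Data.List.Relation.Unary.AllPairs as AllPairs using (AllPairs; []; _∷_)
open import Data.List.Relation.Unary.Any using (here; there)
open import Data.List.Relation.Unary.Linked using (Linked; _∷_)
open import Data.List.Relation.Unary.Linked.Properties using (AllPairs⇒Linked)
open import Data.List.Relation.Unary.Unique.Propositional using (Unique)
import Data.List.Relation.Unary.Unique.Propositional.Properties as Unique
open import Data.Nat.Base as ℕ using (ℕ; zero; suc; z≤n; s≤s)
import Data.Nat.Properties as ℕ
open import Data.Product.Base using (_×_; _,_; ∃-syntax; proj₁; proj₂)
open import Data.Sum.Base using (_⊎_; inj₁; inj₂)
open import Data.Unit.Base using (⊤; tt)
open import Defs
open import Function.Base using (_∘_; _on_)
open import Function.Bundles using (_⇔_; mk⇔; Equivalence)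
open import Level using (0ℓ)
import Relation.Binary.Reasoning.Setoid as SetoidReasoning
open import Relation.Binary.PropositionalEquality as ≡ using (_≡_; _≢_; refl; cong; subst)
open import Relation.Binary.Structures using (IsEquivalence)
open import Relation.Nullary using (¬_; yes; no; contradiction)
open import Relation.Nullary.Decidable using (isYes≗does; dec-true; dec-false)

-- Finite sums over lists in a commutative semiring.

module Sums {c ℓ} (S : CommutativeSemiring c ℓ) where
  open CommutativeSemiring S renaming (refl to ≈-refl)

  module _ {i} {A : Set i} where
    ∑ : List A → (A → Carrier) → Carrier
    ∑ xs f = foldr _+_ 0# (map f xs)

    ∑-++ : ∀ xs ys f → ∑ (xs ++ ys) f ≈ ∑ xs f + ∑ ys f
    ∑-++ []       ys f = sym (+-identityˡ _)
    ∑-++ (x ∷ xs) ys f = trans (+-congˡ (∑-++ xs ys f)) (sym (+-assoc _ _ _))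

    ∑-cong : ∀ xs {f g} → (∀ {x} → x ∈ xs → f x ≈ g x) → ∑ xs f ≈ ∑ xs g
    ∑-cong []       f≈g = ≈-refl
    ∑-cong (x ∷ xs) f≈g = +-cong (f≈g (here refl)) (∑-cong xs (f≈g ∘ there))

    ∑-* : ∀ xs h f → ∑ xs (λ x → h * f x) ≈ h * ∑ xs f
    ∑-* []       h f = sym (zeroʳ h)
    ∑-* (x ∷ xs) h f = trans (+-congˡ (∑-* xs h f)) (sym (distribˡ h _ _))

    ∑-↭ : ∀ {xs zs} f → xs ↭ zs → ∑ xs f ≈ ∑ zs f
    ∑-↭ f ↭.refl         = ≈-refl
    ∑-↭ f (↭.prep x p)   = +-congˡ (∑-↭ f p)
    ∑-↭ f (↭.swap x z p) =
      trans (sym (+-assoc _ _ _)) (trans (+-cong (+-comm _ _) (∑-↭ f p)) (+-assoc _ _ _))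
    ∑-↭ f (↭.trans p q)  = trans (∑-↭ f p) (∑-↭ f q)

  module _ {i j} {A : Set i} {C : Set j} where
    ∑-map : ∀ xs (g : A → C) f → ∑ (map g xs) f ≡ ∑ xs (f ∘ g)
    ∑-map []       g f = refl
    ∑-map (x ∷ xs) g f = cong (λ s → f (g x) + s) (∑-map xs g f)

    ∑-concatMap : ∀ xs (g : A → List C) f → ∑ (concatMap g xs) f ≈ ∑ xs (λ x → ∑ (g x) f)
    ∑-concatMap []       g f = ≈-refl
    ∑-concatMap (x ∷ xs) g f =
      trans (∑-++ (g x) (concatMap g xs) f) (+-congˡ (∑-concatMap xs g f))

-- Polynomials in the three weights.

infixl 6 _⊕_
infixl 7 _⊗_

-- With _≋_ as equality, this is the free commutative semiring on three generators.
data Poly : Set where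
  𝐲 𝐚 𝐝 𝟘 𝟙 : Poly
  _⊕_ _⊗_   : Poly → Poly → Poly

infix 4 _≋_
data _≋_ : Poly → Poly → Set where
  ≋-refl       : ∀ {f} → f ≋ f
  ≋-sym        : ∀ {f g} → f ≋ g → g ≋ f
  ≋-trans      : ∀ {f g h} → f ≋ g → g ≋ h → f ≋ h
  ⊕-cong       : ∀ {f f′ g g′} → f ≋ f′ → g ≋ g′ → f ⊕ g ≋ f′ ⊕ g′
  ⊕-assoc      : ∀ f g h → (f ⊕ g) ⊕ h ≋ f ⊕ (g ⊕ h)
  ⊕-comm       : ∀ f g → f ⊕ g ≋ g ⊕ f
  ⊕-identityˡ  : ∀ f → 𝟘 ⊕ f ≋ f
  ⊗-cong       : ∀ {f f′ g g′} → f ≋ f′ → g ≋ g′ → f ⊗ g ≋ f′ ⊗ g′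
  ⊗-assoc      : ∀ f g h → (f ⊗ g) ⊗ h ≋ f ⊗ (g ⊗ h)
  ⊗-comm       : ∀ f g → f ⊗ g ≋ g ⊗ f
  ⊗-identityˡ  : ∀ f → 𝟙 ⊗ f ≋ f
  ⊗-distribʳ-⊕ : ∀ f g h → (g ⊕ h) ⊗ f ≋ g ⊗ f ⊕ h ⊗ f
  ⊗-zeroˡ      : ∀ f → 𝟘 ⊗ f ≋ 𝟘

poly : CommutativeSemiring 0ℓ 0ℓ
poly = record { isCommutativeSemiring = isCommutativeSemiringˡ record
  { +-isCommutativeMonoid = record
    { isMonoid = record
      { isSemigroup = record
        { isMagma = record { isEquivalence = ≋-isEquivalence ; ∙-cong = ⊕-cong }
        ; assoc = ⊕-assoc
        }
      ; identity = ⊕-identityˡ , λ f → ≋-trans (⊕-comm f 𝟘) (⊕-identityˡ f)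
      }
    ; comm = ⊕-comm
    }
  ; *-isCommutativeMonoid = record
    { isMonoid = record
      { isSemigroup = record
        { isMagma = record { isEquivalence = ≋-isEquivalence ; ∙-cong = ⊗-cong }
        ; assoc = ⊗-assoc
        }
      ; identity = ⊗-identityˡ , λ f → ≋-trans (⊗-comm f 𝟙) (⊗-identityˡ f)
      }
    ; comm = ⊗-comm
    }
  ; distribʳ = ⊗-distribʳ-⊕
  ; zeroˡ = ⊗-zeroˡ
  } }
  where
  ≋-isEquivalence : IsEquivalence _≋_
  ≋-isEquivalence = record { refl = ≋-refl ; sym = ≋-sym ; trans = ≋-trans }

private
  module K = CommutativeSemiring poly
open Sums poly

-- The derivation `D` and the operator `T`.

module _ where
  open Solver poly using (solve; _:=_; _:+_; _:*_; con)
  open SetoidReasoning K.setoid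

  -- The Leibniz rule is imposed by recursion on expressions; `D-cong` then checks that it respects
  -- each semiring law.
  D : Poly → Poly
  D 𝐲       = 𝟘
  D 𝐚       = (𝟙 ⊕ 𝐲) ⊗ 𝐚 ⊗ 𝐝
  D 𝐝       = (𝟙 ⊕ 𝐲) ⊗ 𝐚 ⊗ 𝐝
  D 𝟘       = 𝟘
  D 𝟙       = 𝟘
  D (f ⊕ g) = D f ⊕ D g
  D (f ⊗ g) = D f ⊗ g ⊕ f ⊗ D g

  D-cong : ∀ {f g} → f ≋ g → D f ≋ D g
  D-cong ≋-refl               = ≋-refl
  D-cong (≋-sym p)            = ≋-sym (D-cong p)
  D-cong (≋-trans p q)        = ≋-trans (D-cong p) (D-cong q)
  D-cong (⊕-cong p q)         = ⊕-cong (D-cong p) (D-cong q)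
  D-cong (⊕-assoc f g h)      = ⊕-assoc (D f) (D g) (D h)
  D-cong (⊕-comm f g)         = ⊕-comm (D f) (D g)
  D-cong (⊕-identityˡ f)      = ⊕-identityˡ (D f)
  D-cong (⊗-cong p q)         = ⊕-cong (⊗-cong (D-cong p) q) (⊗-cong p (D-cong q))
  D-cong (⊗-assoc f g h)      = solve 6 (λ f g h f′ g′ h′ →
    (f′ :* g :+ f :* g′) :* h :+ f :* g :* h′ := f′ :* (g :* h) :+ f :* (g′ :* h :+ g :* h′))
    ≋-refl f g h (D f) (D g) (D h)
  D-cong (⊗-comm f g)         = solve 4 (λ f g f′ g′ → f′ :* g :+ f :* g′ := g′ :* f :+ g :* f′)
    ≋-refl f g (D f) (D g)
  D-cong (⊗-identityˡ f)      = solve 2 (λ f f′ → con 0 :* f :+ con 1 :* f′ := f′) ≋-refl f (D f)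
  D-cong (⊗-distribʳ-⊕ f g h) = solve 6 (λ f g h f′ g′ h′ →
    (g′ :+ h′) :* f :+ (g :+ h) :* f′ := (g′ :* f :+ g :* f′) :+ (h′ :* f :+ h :* f′))
    ≋-refl f g h (D f) (D g) (D h)
  D-cong (⊗-zeroˡ f)          = solve 2 (λ f f′ → con 0 :* f :+ con 0 :* f′ := con 0) ≋-refl f (D f)

  p α δ : Poly
  p = (𝟙 ⊕ 𝐲) ⊗ (𝟙 ⊕ 𝐲) ⊗ 𝐚 ⊗ 𝐝
  α = 𝐚 ⊕ 𝐲 ⊗ 𝐝
  δ = 𝐝 ⊕ 𝐲 ⊗ 𝐚

  D-α : D α ≋ p
  D-α = solve 3 (λ y a d →
    let e = (con 1 :+ y) :* a :* d in
    e :+ (con 0 :* d :+ y :* e) := (con 1 :+ y) :* (con 1 :+ y) :* a :* d) ≋-refl 𝐲 𝐚 𝐝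

  D-δ : D δ ≋ p
  D-δ = solve 3 (λ y a d →
    let e = (con 1 :+ y) :* a :* d in
    e :+ (con 0 :* a :+ y :* e) := (con 1 :+ y) :* (con 1 :+ y) :* a :* d) ≋-refl 𝐲 𝐚 𝐝

  -- `𝟙 ⊕ 𝐲` is a constant for `D`, so only `𝐚 ⊗ 𝐝` contributes; it is multiplied by
  -- `(𝟙 ⊕ 𝐲) ⊗ (𝐚 ⊕ 𝐝)`, which is `α ⊕ δ`.
  D-p : D p ≋ p ⊗ (α ⊕ δ)
  D-p = solve 3 (λ y a d →
    let q = con 1 :+ y ; e = q :* a :* d in
    (((con 0 :+ con 0) :* q :+ q :* (con 0 :+ con 0)) :* a :+ q :* q :* e) :* d :+ q :* q :* a :* e
      := q :* q :* a :* d :* (a :+ y :* d :+ (d :+ y :* a))) ≋-refl 𝐲 𝐚 𝐝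

  T : Poly → Poly
  T f = D f ⊕ f ⊗ α

  T-cong : ∀ {f g} → f ≋ g → T f ≋ T g
  T-cong f≋g = ⊕-cong (D-cong f≋g) (⊗-cong f≋g ≋-refl)

  ∑-T : ∀ {i} {A : Set i} (xs : List A) f → ∑ xs (T ∘ f) ≋ T (∑ xs f)
  ∑-T []       f = solve 1 (λ b → con 0 := con 0 :+ con 0 :* b) ≋-refl α
  ∑-T (x ∷ xs) f = ≋-trans (⊕-cong ≋-refl (∑-T xs f))
    (solve 5 (λ u u′ v v′ b → (u′ :+ u :* b) :+ (v′ :+ v :* b) := (u′ :+ v′) :+ (u :+ v) :* b)
      ≋-refl (f x) (D (f x)) (∑ xs f) (D (∑ xs f)) α)

  -- Weights of words, and insertion of a letter of largest absolute value.

  insertions : ℤ → List ℤ → List (List ℤ)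
  insertions x []      = (x ∷ []) ∷ []
  insertions x (z ∷ w) = (x ∷ z ∷ w) ∷ map (z ∷_) (insertions x w)

  <⇒<ᵇ : ∀ {x z} → x ℤ.< z → (x <ᵇ z) ≡ true
  <⇒<ᵇ {x} {z} x<z = ≡.trans (isYes≗does (x ℤ.<? z)) (dec-true (x ℤ.<? z) x<z)

  ≮⇒<ᵇ : ∀ {x z} → ¬ x ℤ.< z → (x <ᵇ z) ≡ false
  ≮⇒<ᵇ {x} {z} x≮z = ≡.trans (isYes≗does (x ℤ.<? z)) (dec-false (x ℤ.<? z) x≮z)

  Below : ℕ → ℤ → Set
  Below m x = ∣ x ∣ ℕ.< m

  Below⇒<+ : ∀ {m} x → Below m x → x ℤ.< + m
  Below⇒<+ (+ _)      x<m = ℤ.+<+ x<m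
  Below⇒<+ (-[1+ _ ]) _   = ℤ.-<+

  Below⇒-< : ∀ {m} x → Below m x → ℤ.- + m ℤ.< x
  Below⇒-< {suc m} (+ _)      _           = ℤ.-<+
  Below⇒-< {suc m} (-[1+ k ]) (ℕ.s≤s k<m) = ℤ.-<- k<m

  step : ℤ → ℤ → Poly
  step c x = if x <ᵇ c then 𝐝 else 𝐚

  sign : ℤ → Poly
  sign x = if x <ᵇ 0ℤ then 𝐲 else 𝟙

  -- The letter `c` is only compared with the first letter and carries no sign; `c = 0ℤ` accounts
  -- for the descent at position 0 in `des-B`.
  β : ℤ → List ℤ → Poly
  β c []      = 𝟙
  β c (x ∷ w) = sign x ⊗ step c x ⊗ β x w

  -- ω↓ and ω↑ weight a word that follows a letter c; in ω↑ c the step into c was an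
  -- ascent, which is not yet weighted because c may turn out to be a peak.
  ω↓ ω↑ : ℤ → List ℤ → Poly
  ω↓ c []      = 𝟙
  ω↓ c (x ∷ w) = if x <ᵇ c then δ ⊗ ω↓ x w else ω↑ x w
  ω↑ c []      = α
  ω↑ c (x ∷ w) = if x <ᵇ c then p ⊗ ω↓ x w else α ⊗ ω↑ x w

  D-step : ∀ c x → D (step c x) ≡ (𝟙 ⊕ 𝐲) ⊗ 𝐚 ⊗ 𝐝
  D-step c x with x <ᵇ c
  ... | true  = refl
  ... | false = refl

  D-sign : ∀ x → D (sign x) ≡ 𝟘
  D-sign x with x <ᵇ 0ℤ
  ... | true  = refl
  ... | false = refl

  module _ (m : ℕ) where
    private
      M M⁻ : ℤ
      M  = + suc m
      M⁻ = ℤ.- + suc m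

      c<M : ∀ c → Below (suc m) c → (c <ᵇ M) ≡ true
      c<M c b = <⇒<ᵇ (Below⇒<+ _ b)
      M≮c : ∀ c → Below (suc m) c → (M <ᵇ c) ≡ false
      M≮c c b = ≮⇒<ᵇ (ℤ.<-asym (Below⇒<+ _ b))
      M⁻<c : ∀ c → Below (suc m) c → (M⁻ <ᵇ c) ≡ true
      M⁻<c c b = <⇒<ᵇ (Below⇒-< _ b)
      c≮M⁻ : ∀ c → Below (suc m) c → (c <ᵇ M⁻) ≡ false
      c≮M⁻ c b = ≮⇒<ᵇ (ℤ.<-asym (Below⇒-< _ b))

    -- The summands match the Leibniz expansion of `β c w`. Right before `x`, `M` yields `𝐚` then
    -- `𝐝`, and `M⁻` yields `𝐲` times `𝐝` then `𝐚`: in total the derivative of `step c x`. The later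
    -- slots give the derivative of `β x w`, and the last slot gives the factor `α`.
    ∑-insertions-β : ∀ c w → Below (suc m) c → All (Below (suc m)) w →
      ∑ (insertions M w) (β c) ⊕ ∑ (insertions M⁻ w) (β c) ≋ T (β c w)
    ∑-insertions-β c [] c<m [] rewrite M≮c c c<m | M⁻<c c c<m =
      solve 3 (λ y a d → (con 1 :* a :* con 1 :+ con 0) :+ (y :* d :* con 1 :+ con 0)
                           := con 0 :+ con 1 :* (a :+ y :* d)) ≋-refl 𝐲 𝐚 𝐝
    ∑-insertions-β c (x ∷ w) c<m (x<m ∷ w<m)
      rewrite M≮c c c<m | M⁻<c c c<m | c<M x x<m | c≮M⁻ x x<m
            | ∑-map (insertions M w) (x ∷_) (β c) | ∑-map (insertions M⁻ w) (x ∷_) (β c)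
            | D-step c x | D-sign x = begin
      𝟙 ⊗ 𝐚 ⊗ (s ⊗ 𝐝 ⊗ b) ⊕ ∑ (insertions M w) (λ v → s ⊗ r ⊗ β x v)
        ⊕ (𝐲 ⊗ 𝐝 ⊗ (s ⊗ 𝐚 ⊗ b) ⊕ ∑ (insertions M⁻ w) (λ v → s ⊗ r ⊗ β x v))
        ≈⟨ ⊕-cong (⊕-cong ≋-refl (∑-* (insertions M w) (s ⊗ r) (β x)))
                  (⊕-cong ≋-refl (∑-* (insertions M⁻ w) (s ⊗ r) (β x))) ⟩
      𝟙 ⊗ 𝐚 ⊗ (s ⊗ 𝐝 ⊗ b) ⊕ s ⊗ r ⊗ ∑ (insertions M w) (β x)
        ⊕ (𝐲 ⊗ 𝐝 ⊗ (s ⊗ 𝐚 ⊗ b) ⊕ s ⊗ r ⊗ ∑ (insertions M⁻ w) (β x))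
        ≈⟨ solve 8 (λ y a d s r b t t′ →
             con 1 :* a :* (s :* d :* b) :+ s :* r :* t :+ (y :* d :* (s :* a :* b) :+ s :* r :* t′)
               := s :* ((con 1 :+ y) :* a :* d) :* b :+ s :* r :* (t :+ t′))
             ≋-refl 𝐲 𝐚 𝐝 s r b (∑ (insertions M w) (β x)) (∑ (insertions M⁻ w) (β x)) ⟩
      s ⊗ ((𝟙 ⊕ 𝐲) ⊗ 𝐚 ⊗ 𝐝) ⊗ b ⊕ s ⊗ r ⊗ (∑ (insertions M w) (β x) ⊕ ∑ (insertions M⁻ w) (β x))
        ≈⟨ ⊕-cong ≋-refl (⊗-cong ≋-refl (∑-insertions-β x w x<m w<m)) ⟩
      s ⊗ ((𝟙 ⊕ 𝐲) ⊗ 𝐚 ⊗ 𝐝) ⊗ b ⊕ s ⊗ r ⊗ (D b ⊕ b ⊗ α)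
        ≈⟨ solve 6 (λ s r e b b′ q → s :* e :* b :+ s :* r :* (b′ :+ b :* q) :=
             ((con 0 :* r :+ s :* e) :* b :+ s :* r :* b′) :+ s :* r :* b :* q)
             ≋-refl s r ((𝟙 ⊕ 𝐲) ⊗ 𝐚 ⊗ 𝐝) b (D b) α ⟩
      (𝟘 ⊗ r ⊕ s ⊗ ((𝟙 ⊕ 𝐲) ⊗ 𝐚 ⊗ 𝐝)) ⊗ b ⊕ s ⊗ r ⊗ D b ⊕ s ⊗ r ⊗ b ⊗ α ∎
      where
      s r b : Poly
      s = sign x
      r = step c x
      b = β x w

    -- If a letter follows `c`, then `M` placed between them is a peak, of weight `p`. If that
    -- letter is below `c`, this replaces `δ`, whose derivative is `p`. If it is some `x` above `c`,
    -- the term `p ⊗ ω↓ x w` is exactly the extra summand in `∑-insertions-ω↑` at `x`.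
    ∑-insertions-ω↓ : ∀ c w → Below (suc m) c → All (Below (suc m)) w →
      ∑ (insertions M w) (ω↓ c) ≋ T (ω↓ c w)
    -- The extra summand is the insertion just before c, which makes c a non-peak.
    ∑-insertions-ω↑ : ∀ c w → Below (suc m) c → All (Below (suc m)) w →
      p ⊗ ω↓ c w ⊕ ∑ (insertions M w) (ω↑ c) ≋ T (ω↑ c w)
    ∑-insertions-ω↓ c [] c<m [] rewrite M≮c c c<m =
      solve 1 (λ q → q :+ con 0 := con 0 :+ con 1 :* q) ≋-refl α
    ∑-insertions-ω↓ c (x ∷ w) c<m (x<m ∷ w<m)
      rewrite M≮c c c<m | c<M x x<m | ∑-map (insertions M w) (x ∷_) (ω↓ c) with x <ᵇ c
    ... | true  = begin
      p ⊗ o ⊕ ∑ (insertions M w) (λ v → δ ⊗ ω↓ x v)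
        ≈⟨ ⊕-cong ≋-refl (∑-* (insertions M w) δ (ω↓ x)) ⟩
      p ⊗ o ⊕ δ ⊗ ∑ (insertions M w) (ω↓ x)
        ≈⟨ ⊕-cong (⊗-cong (≋-sym D-δ) ≋-refl) (⊗-cong ≋-refl (∑-insertions-ω↓ x w x<m w<m)) ⟩
      D δ ⊗ o ⊕ δ ⊗ (D o ⊕ o ⊗ α)
        ≈⟨ solve 5 (λ r r′ o o′ q → r′ :* o :+ r :* (o′ :+ o :* q) :=
             (r′ :* o :+ r :* o′) :+ r :* o :* q) ≋-refl δ (D δ) o (D o) α ⟩
      T (δ ⊗ o) ∎
      where
      o : Poly
      o = ω↓ x w
    ... | false = ∑-insertions-ω↑ x w x<m w<m
    ∑-insertions-ω↑ c [] c<m [] rewrite M≮c c c<m = begin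
      -- Before `c`, `M` is a peak; after `c`, it adds a second ordinary ascent.
      p ⊗ 𝟙 ⊕ (α ⊗ α ⊕ 𝟘)
        ≈⟨ solve 2 (λ p q → p :* con 1 :+ (q :* q :+ con 0) := p :+ q :* q) ≋-refl p α ⟩
      p ⊕ α ⊗ α ≈⟨ ⊕-cong (≋-sym D-α) ≋-refl ⟩
      T α ∎
    ∑-insertions-ω↑ c (x ∷ w) c<m (x<m ∷ w<m)
      rewrite M≮c c c<m | c<M x x<m | ∑-map (insertions M w) (x ∷_) (ω↑ c) with x <ᵇ c
    ... | true  = begin
      -- The peak `c` is destroyed from either side: `M` before it leaves its descent as `δ`, `M`
      -- after it leaves its ascent as `α`, and each time `M` is itself a peak. Together this is
      -- `D p`.
      p ⊗ (δ ⊗ o) ⊕ (α ⊗ (p ⊗ o) ⊕ ∑ (insertions M w) (λ v → p ⊗ ω↓ x v))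
        ≈⟨ ⊕-cong ≋-refl (⊕-cong ≋-refl (∑-* (insertions M w) p (ω↓ x))) ⟩
      p ⊗ (δ ⊗ o) ⊕ (α ⊗ (p ⊗ o) ⊕ p ⊗ ∑ (insertions M w) (ω↓ x))
        ≈⟨ solve 5 (λ p q r o t → p :* (r :* o) :+ (q :* (p :* o) :+ p :* t) :=
             p :* (q :+ r) :* o :+ p :* t) ≋-refl p α δ o (∑ (insertions M w) (ω↓ x)) ⟩
      p ⊗ (α ⊕ δ) ⊗ o ⊕ p ⊗ ∑ (insertions M w) (ω↓ x)
        ≈⟨ ⊕-cong (⊗-cong (≋-sym D-p) ≋-refl) (⊗-cong ≋-refl (∑-insertions-ω↓ x w x<m w<m)) ⟩
      D p ⊗ o ⊕ p ⊗ (D o ⊕ o ⊗ α)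
        ≈⟨ solve 5 (λ r r′ o o′ q → r′ :* o :+ r :* (o′ :+ o :* q) :=
             (r′ :* o :+ r :* o′) :+ r :* o :* q) ≋-refl p (D p) o (D o) α ⟩
      T (p ⊗ o) ∎
      where
      o : Poly
      o = ω↓ x w
    ... | false = begin
      -- The insertion before `c` is accounted for by `D α`; the one between `c` and `x` is the
      -- extra summand of the recursive call, times the `α` of the ascent into `c`.
      p ⊗ ω↑ x w ⊕ (α ⊗ (p ⊗ ω↓ x w) ⊕ ∑ (insertions M w) (λ v → α ⊗ ω↑ x v))
        ≈⟨ ⊕-cong ≋-refl (⊕-cong ≋-refl (∑-* (insertions M w) α (ω↑ x))) ⟩
      p ⊗ ω↑ x w ⊕ (α ⊗ (p ⊗ ω↓ x w) ⊕ α ⊗ ∑ (insertions M w) (ω↑ x))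
        ≈⟨ ⊕-cong ≋-refl (K.distribˡ α _ _) ⟨
      p ⊗ ω↑ x w ⊕ α ⊗ (p ⊗ ω↓ x w ⊕ ∑ (insertions M w) (ω↑ x))
        ≈⟨ ⊕-cong (⊗-cong (≋-sym D-α) ≋-refl) (⊗-cong ≋-refl (∑-insertions-ω↑ x w x<m w<m)) ⟩
      D α ⊗ ω↑ x w ⊕ α ⊗ (D (ω↑ x w) ⊕ ω↑ x w ⊗ α)
        ≈⟨ solve 5 (λ r r′ o o′ q → r′ :* o :+ r :* (o′ :+ o :* q) :=
             (r′ :* o :+ r :* o′) :+ r :* o :* q) ≋-refl α (D α) (ω↑ x w) (D (ω↑ x w)) α ⟩
      T (α ⊗ ω↑ x w) ∎

-- Arrangements built by inserting the letter of largest absolute value.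

module _ {i j} {A : Set i} {C : Set j} where
  Unique-concatMap⁺ : ∀ {F : A → List C} {xs} → Unique xs → (∀ {x} → x ∈ xs → Unique (F x)) →
    (∀ {x x′ v} → x ∈ xs → x′ ∈ xs → v ∈ F x → v ∈ F x′ → x ≡ x′) → Unique (concatMap F xs)
  Unique-concatMap⁺ []             F! disjoint = []
  Unique-concatMap⁺ {F} {x ∷ xs} x∷xs!@(_ ∷ xs!) F! disjoint = Unique.++⁺ (F! (here refl))
    (Unique-concatMap⁺ xs! (F! ∘ there) λ x∈ x′∈ → disjoint (there x∈) (there x′∈))
    λ (v∈Fx , v∈rest) → let x′ , x′∈xs , v∈Fx′ = find (∈-concatMap⁻ F v∈rest) in
      Unique.Unique[x∷xs]⇒x∉xs x∷xs!
        (subst (_∈ xs) (≡.sym (disjoint (here refl) (there x′∈xs) v∈Fx v∈Fx′)) x′∈xs)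

module _ {i p r s} {A : Set i} {P : A → Set p} {R : A → A → Set r} {S : A → A → Set s} where
  AllPairs-map-All : (∀ {x z} → P x → P z → R x z → S x z) →
    ∀ {xs} → All P xs → AllPairs R xs → AllPairs S xs
  AllPairs-map-All f []         []         = []
  AllPairs-map-All f (px ∷ pxs) (rx ∷ rxs) =
    All.zipWith (λ (pz , r) → f px pz r) (pxs , rx) ∷ AllPairs-map-All f pxs rxs

data Inserted (x : ℤ) : List ℤ → List ℤ → Set where
  here  : ∀ {w} → Inserted x w (x ∷ w)
  there : ∀ {z w v} → Inserted x w v → Inserted x (z ∷ w) (z ∷ v)

module _ {x : ℤ} where
  ∈-insertions⁺ : ∀ {w v} → Inserted x w v → v ∈ insertions x w
  ∈-insertions⁺ {[]}    here      = here refl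
  ∈-insertions⁺ {_ ∷ _} here      = here refl
  ∈-insertions⁺ {z ∷ _} (there p) = there (∈-map⁺ (z ∷_) (∈-insertions⁺ p))

  ∈-insertions⁻ : ∀ w {v} → v ∈ insertions x w → Inserted x w v
  ∈-insertions⁻ []      (here refl) = here
  ∈-insertions⁻ (z ∷ w) (here refl) = here
  ∈-insertions⁻ (z ∷ w) (there v∈)
    with v′ , v′∈ , refl ← ∈-map⁻ (z ∷_) v∈ = there (∈-insertions⁻ w v′∈)

  Inserted-length : ∀ {w v} → Inserted x w v → length v ≡ suc (length w)
  Inserted-length here      = refl
  Inserted-length (there p) = cong suc (Inserted-length p)

  module _ {P : ℤ → Set} where
    All-Inserted⁺ : ∀ {w v} → Inserted x w v → P x → All P w → All P v
    All-Inserted⁺ here      px pw        = px ∷ pw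
    All-Inserted⁺ (there p) px (pz ∷ pw) = pz ∷ All-Inserted⁺ p px pw

    All-Inserted⁻ : ∀ {w v} → Inserted x w v → All P v → P x × All P w
    All-Inserted⁻ here      (px ∷ pw) = px , pw
    All-Inserted⁻ (there p) (pz ∷ pv) = let px , pw = All-Inserted⁻ p pv in px , pz ∷ pw

Fresh : ℤ → List ℤ → Set
Fresh x = All λ z → ∣ x ∣ ≢ ∣ z ∣

-- Absolute values suit both families: on positive words this is ordinary distinctness, and on
-- signed words it also excludes `x` together with `- x`.
Distinct : List ℤ → Set
Distinct = AllPairs (_≢_ on ∣_∣)

-- The inserted letter can be located in `v`, being the only one with its absolute value. Only the
-- absolute values of `x` and `x′` are assumed equal, so the sign is recovered as well.
Inserted-injective : ∀ {x x′ w w′ v} → ∣ x ∣ ≡ ∣ x′ ∣ → Fresh x w → Fresh x′ w′ →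
  Inserted x w v → Inserted x′ w′ v → x ≡ x′ × w ≡ w′
Inserted-injective e f        f′         here      here      = refl , refl
Inserted-injective e f        (x≢ ∷ _)   here      (there q) = contradiction (≡.sym e) x≢
Inserted-injective e (x≢ ∷ _) f′         (there p) here      = contradiction e x≢
Inserted-injective e (_ ∷ f)  (_ ∷ f′)   (there p) (there q)
  with refl , refl ← Inserted-injective e f f′ p q = refl , refl

insertions-Unique : ∀ x {w} → Fresh x w → Unique (insertions x w)
insertions-Unique x []        = [] ∷ []
insertions-Unique x (x≢z ∷ f) =
  All.map⁺ (All.universal (λ v eq → x≢z (cong ∣_∣ (proj₁ (∷-injective eq)))) _)
    ∷ Unique.map⁺ (proj₂ ∘ ∷-injective) (insertions-Unique x f)

Distinct-Inserted : ∀ {x w v} → Inserted x w v → Fresh x w → Distinct w → Distinct v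
Distinct-Inserted here      f          w!        = f ∷ w!
Distinct-Inserted (there p) (x≢z ∷ f) (z≢w ∷ w!) =
  All-Inserted⁺ p (x≢z ∘ ≡.sym) z≢w ∷ Distinct-Inserted p f w!

_∈±[1,_] : ℤ → ℕ → Set
x ∈±[1, n ] = 1 ℕ.≤ ∣ x ∣ × ∣ x ∣ ℕ.≤ n

-- By distinctness at most one letter has absolute value `suc n`, so without it the rest lies in the
-- smaller range.
extractMaximum : ∀ {n w} → Distinct w → All (_∈±[1, suc n ]) w →
  All (_∈±[1, n ]) w ⊎ ∃[ x ] ∃[ v ] ∣ x ∣ ≡ suc n × Inserted x v w × All (_∈±[1, n ]) v × Distinct v
extractMaximum []         []                      = inj₁ []
extractMaximum {n} {x ∷ w} (x≢w ∷ w!) ((1≤x , x≤1+n) ∷ w≤1+n) with ∣ x ∣ ℕ.≟ suc n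
... | yes ∣x∣≡1+n = inj₂ (x , w , ∣x∣≡1+n , here ,
  All.zipWith (λ (x≢z , 1≤z , z≤1+n) →
    1≤z , ℕ.≤-pred (ℕ.≤∧≢⇒< z≤1+n λ z≡1+n → x≢z (≡.trans ∣x∣≡1+n (≡.sym z≡1+n)))) (x≢w , w≤1+n) , w!)
... | no  ∣x∣≢1+n with extractMaximum w! w≤1+n
...   | inj₁ w≤n = inj₁ ((1≤x , ℕ.≤-pred (ℕ.≤∧≢⇒< x≤1+n ∣x∣≢1+n)) ∷ w≤n)
...   | inj₂ (z , v , ∣z∣≡1+n , p , v≤n , v!) =
  inj₂ (z , x ∷ v , ∣z∣≡1+n , there p
       , (1≤x , ℕ.≤-pred (ℕ.≤∧≢⇒< x≤1+n ∣x∣≢1+n)) ∷ v≤n , proj₂ (All-Inserted⁻ p x≢w) ∷ v!)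

-- The pigeonhole principle, by induction on the range.
length≤ : ∀ n {w} → Distinct w → All (_∈±[1, n ]) w → length w ℕ.≤ n
length≤ zero    {[]}    _  _                 = z≤n
length≤ zero    {_ ∷ _} _  ((1≤x , x≤0) ∷ _) = contradiction (ℕ.≤-trans 1≤x x≤0) λ ()
length≤ (suc n) {w}     w! w≤1+n with extractMaximum w! w≤1+n
... | inj₁ w≤n = ℕ.m≤n⇒m≤1+n (length≤ n w! w≤n)
... | inj₂ (_ , _ , _ , p , v≤n , v!) =
  subst (ℕ._≤ suc n) (≡.sym (Inserted-length p)) (s≤s (length≤ n v! v≤n))

record Arrangement (n : ℕ) (w : List ℤ) : Set where
  constructor arrangement
  field
    length≡  : length w ≡ n
    range    : All (_∈±[1, n ]) w
    distinct : Distinct w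
open Arrangement

Arrangement-extractMaximum : ∀ {n w} → Arrangement (suc n) w →
  ∃[ x ] ∃[ v ] ∣ x ∣ ≡ suc n × Inserted x v w × Arrangement n v
Arrangement-extractMaximum {n} A with extractMaximum (distinct A) (range A)
-- Here `suc n` letters would have distinct absolute values among only `n`.
... | inj₁ w≤n =
  contradiction (subst (ℕ._≤ n) (length≡ A) (length≤ n (distinct A) w≤n)) ℕ.1+n≰n
... | inj₂ (x , v , ∣x∣≡1+n , p , v≤n , v!) = x , v , ∣x∣≡1+n , p ,
  arrangement (ℕ.suc-injective (≡.trans (≡.sym (Inserted-length p)) (length≡ A))) v≤n v!

Arrangement-Fresh : ∀ {n w x} → ∣ x ∣ ≡ suc n → Arrangement n w → Fresh x w
Arrangement-Fresh ∣x∣≡1+n A = All.map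
  (λ (_ , ∣z∣≤n) x≡z → ℕ.1+n≰n (ℕ.≤-trans (ℕ.≤-reflexive (≡.trans (≡.sym ∣x∣≡1+n) x≡z)) ∣z∣≤n)) (range A)

Arrangement-insert : ∀ {n w v x} → ∣ x ∣ ≡ suc n → Inserted x w v →
  Arrangement n w → Arrangement (suc n) v
Arrangement-insert {x = x} ∣x∣≡1+n p A = arrangement
  (≡.trans (Inserted-length p) (cong suc (length≡ A)))
  (All-Inserted⁺ p (subst (1 ℕ.≤_) (≡.sym ∣x∣≡1+n) (s≤s z≤n) , ℕ.≤-reflexive ∣x∣≡1+n)
    (All.map (λ (1≤z , ∣z∣≤n) → 1≤z , ℕ.m≤n⇒m≤1+n ∣z∣≤n) (range A)))
  (Distinct-Inserted p (Arrangement-Fresh {x = x} ∣x∣≡1+n A) (distinct A))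

-- `S` is the sign condition: positivity for permutations, no restriction for signed permutations.
record Enumerates (S : ℤ → Set) (n : ℕ) (𝔏 : List (List ℤ)) : Set where
  field
    unique : Unique 𝔏
    member : ∀ {w} → w ∈ 𝔏 ⇔ (Arrangement n w × All S w)
open Enumerates

insertAll : List ℤ → List ℤ → List (List ℤ)
insertAll L w = concatMap (λ x → insertions x w) L

module _ {S : ℤ → Set} {n : ℕ} {L : List ℤ}
         (L! : Unique L) (L-member : ∀ {x} → x ∈ L ⇔ (∣ x ∣ ≡ suc n × S x)) where
  private
    module L-member {x} = Equivalence (L-member {x})

    insertAll⁻ : ∀ {w v} → v ∈ insertAll L w → ∃[ x ] x ∈ L × Inserted x w v
    insertAll⁻ {w} v∈ = let x , x∈L , v∈x = find (∈-concatMap⁻ (λ x → insertions x w) v∈)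
      in x , x∈L , ∈-insertions⁻ w v∈x

  -- Nothing is repeated because the inserted letter and the remaining word can be recovered;
  -- nothing is missed because every arrangement of size `suc n` contains a letter of absolute value
  -- `suc n`.
  Enumerates-insertAll : ∀ {𝔏} → Enumerates S n 𝔏 → Enumerates S (suc n) (concatMap (insertAll L) 𝔏)
  Enumerates-insertAll {𝔏} E = record
    { unique = Unique-concatMap⁺ (unique E)
        (λ w∈ → Unique-concatMap⁺ L!
          (λ {x} x∈L → insertions-Unique x (fresh x∈L w∈))
          λ x∈ x′∈ v∈ v∈′ → proj₁ (inj x∈ x′∈ w∈ w∈ (∈-insertions⁻ _ v∈) (∈-insertions⁻ _ v∈′)))
        λ w∈ w′∈ v∈ v∈′ → let _ , x∈ , p = insertAll⁻ v∈ ; _ , x′∈ , p′ = insertAll⁻ v∈′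
          in proj₂ (inj x∈ x′∈ w∈ w′∈ p p′)
    ; member = mk⇔ to from
    }
    where
    module E {w} = Equivalence (member E {w})
    fresh : ∀ {x w} → x ∈ L → w ∈ 𝔏 → Fresh x w
    fresh {x} x∈ w∈ = Arrangement-Fresh {x = x} (proj₁ (L-member.to x∈)) (proj₁ (E.to w∈))
    inj : ∀ {x x′ w w′ v} → x ∈ L → x′ ∈ L → w ∈ 𝔏 → w′ ∈ 𝔏 →
          Inserted x w v → Inserted x′ w′ v → x ≡ x′ × w ≡ w′
    inj x∈ x′∈ w∈ w′∈ = Inserted-injective
      (≡.trans (proj₁ (L-member.to x∈)) (≡.sym (proj₁ (L-member.to x′∈)))) (fresh x∈ w∈) (fresh x′∈ w′∈)
    to : ∀ {v} → v ∈ concatMap (insertAll L) 𝔏 → Arrangement (suc n) v × All S v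
    to v∈ =
      let w , w∈ , v∈w = find (∈-concatMap⁻ (insertAll L) v∈)
          x , x∈ , p   = insertAll⁻ v∈w
          ∣x∣≡1+n , Sx = L-member.to x∈
          A , Sw       = E.to w∈
      in Arrangement-insert ∣x∣≡1+n p A , All-Inserted⁺ p Sx Sw
    from : ∀ {v} → Arrangement (suc n) v × All S v → v ∈ concatMap (insertAll L) 𝔏
    from (A , Sv) =
      let x , w , ∣x∣≡1+n , p , Aw = Arrangement-extractMaximum A
          Sx , Sw = All-Inserted⁻ p Sv
      in ∈-concatMap⁺ (insertAll L) (lose (E.from (Aw , Sw))
           (∈-concatMap⁺ (λ x → insertions x w) (lose (L-member.from (∣x∣≡1+n , Sx)) (∈-insertions⁺ p))))

-- Lists without repetition and with the same members differ only in order, to which sums are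
-- insensitive.
Enumerates-↭ : ∀ {S n 𝔏 𝔏′} → Enumerates S n 𝔏 → Enumerates S n 𝔏′ → 𝔏 ↭ 𝔏′
Enumerates-↭ E E′ = ∼bag⇒↭ (unique∧set⇒bag (unique E) (unique E′)
  (mk⇔ (E′.from ∘ E.to) (E.from ∘ E′.to)))
  where
  module E  {w} = Equivalence (member E {w})
  module E′ {w} = Equivalence (member E′ {w})

-- The lists `𝔖 n` and `𝔅 n` as enumerations of arrangements.

module _ {letters : List ℤ} where
  ∈-words⁻ : ∀ n {w} → w ∈ words letters n → length w ≡ n × All (_∈ letters) w
  ∈-words⁻ zero    (here refl) = refl , []
  ∈-words⁻ (suc n) w∈
    with x , v , x∈ , v∈ , refl ← ∈-cartesianProductWith⁻ _∷_ letters (words letters n) w∈ =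
    let l , v⊆ = ∈-words⁻ n v∈ in cong suc l , x∈ ∷ v⊆

  ∈-words⁺ : ∀ {w} → All (_∈ letters) w → w ∈ words letters (length w)
  ∈-words⁺ []        = here refl
  ∈-words⁺ (x∈ ∷ w⊆) = ∈-cartesianProductWith⁺ _∷_ x∈ (∈-words⁺ w⊆)

  words-Unique : Unique letters → ∀ n → Unique (words letters n)
  words-Unique l! zero    = [] ∷ []
  words-Unique l! (suc n) = Unique.cartesianProductWith⁺ _∷_ ∷-injective l! (words-Unique l! n)

Positive : ℤ → Set
Positive x = 0ℤ ℤ.< x

𝔖-Enumerates : ∀ n → Enumerates Positive n (𝔖 n)
𝔖-Enumerates n = record
  { unique = Unique.filter⁺ _ (words-Unique (Unique.map⁺ (λ { refl → refl }) (Unique.upTo⁺ n)) n)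
  ; member = mk⇔ to from
  }
  where
  letters : List ℤ
  letters = map (λ k → + suc k) (upTo n)
  letter⁻ : ∀ {x} → x ∈ letters → x ∈±[1, n ] × Positive x
  letter⁻ x∈ with k , k∈ , refl ← ∈-map⁻ _ x∈ = (s≤s z≤n , ∈-upTo⁻ k∈) , ℤ.+<+ (s≤s z≤n)
  letter⁺ : ∀ {x} → x ∈±[1, n ] × Positive x → x ∈ letters
  letter⁺ {+ suc k}    ((_ , k<n) , _) = ∈-map⁺ _ (∈-upTo⁺ k<n)
  letter⁺ {+ zero}     ((() , _) , _)
  letter⁺ { -[1+ _ ] } (_ , ())
  ∣∣-injective : ∀ {x z} → Positive x → Positive z → x ≢ z → ∣ x ∣ ≢ ∣ z ∣
  ∣∣-injective {+ _} {+ _} _ _ x≢z ∣x∣≡∣z∣ = x≢z (cong +_ ∣x∣≡∣z∣)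
  to : ∀ {w} → w ∈ 𝔖 n → Arrangement n w × All Positive w
  to w∈ =
    let w∈words , w! = ∈-filter⁻ _ {xs = words letters n} w∈
        l , w⊆ = ∈-words⁻ n w∈words
        pos = All.map (proj₂ ∘ letter⁻) w⊆
    in arrangement l (All.map (proj₁ ∘ letter⁻) w⊆) (AllPairs-map-All ∣∣-injective pos w!) , pos
  from : ∀ {w} → Arrangement n w × All Positive w → w ∈ 𝔖 n
  from {w} (arrangement refl r w! , pos) = ∈-filter⁺ _
    (∈-words⁺ (All.zipWith letter⁺ (r , pos)))
    (AllPairs.map (_∘ cong ∣_∣) w!)

oddExtension-↭ : ∀ w → oddExtension w ↭ map ℤ.-_ w ++ 0ℤ ∷ w
oddExtension-↭ w = ↭.++⁺ʳ (0ℤ ∷ w) (↭.map⁺ ℤ.-_ (↭.↭-reverse w))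

∣x∣≡∣z∣⇒ : ∀ x z → ∣ x ∣ ≡ ∣ z ∣ → x ≡ z ⊎ ℤ.- x ≡ z
∣x∣≡∣z∣⇒ (+ _)       (+ _)       refl = inj₁ refl
∣x∣≡∣z∣⇒ (+ suc _)   (-[1+ _ ])  refl = inj₂ refl
∣x∣≡∣z∣⇒ (-[1+ _ ])  (+ suc _)   refl = inj₂ refl
∣x∣≡∣z∣⇒ (-[1+ _ ])  (-[1+ _ ])  refl = inj₁ refl

-- A letter common to `w` and its negatives would put both `x` and `- x` into `w`; they would be
-- equal by distinctness of absolute values, which forces `x` to be 0.
oddExtension-Unique⁺ : ∀ {w} → All ((1 ℕ.≤_) ∘ ∣_∣) w → Distinct w → Unique (oddExtension w)
oddExtension-Unique⁺ {w} w≢0 w! = ↭ₛ.Unique-resp-↭ (≡.setoid ℤ) (↭⇒↭ₛ (↭-sym (oddExtension-↭ w)))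
  (Unique.++⁺ (Unique.map⁺ ℤ.neg-injective w!′) (All.map (λ { 1≤0 refl → ℕ.1+n≰n 1≤0 }) w≢0 ∷ w!′) disjoint)
  where
  w!′ : Unique w
  w!′ = AllPairs.map (_∘ cong ∣_∣) w!
  unique-∣∣ : ∀ {w x z} → Distinct w → x ∈ w → z ∈ w → ∣ x ∣ ≡ ∣ z ∣ → x ≡ z
  unique-∣∣ w!       (here refl) (here refl) e = refl
  unique-∣∣ (x≢ ∷ _) (here refl) (there z∈)  e = contradiction e (All.lookup x≢ z∈)
  unique-∣∣ (z≢ ∷ _) (there x∈)  (here refl) e = contradiction (≡.sym e) (All.lookup z≢ x∈)
  unique-∣∣ (_ ∷ w!) (there x∈)  (there z∈)  e = unique-∣∣ w! x∈ z∈ e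
  -x≢x : ∀ {x} → 1 ℕ.≤ ∣ x ∣ → ℤ.- x ≢ x
  -x≢x {+ suc _} _ ()
  disjoint : ∀ {v} → v ∈ map ℤ.-_ w × v ∈ 0ℤ ∷ w → ⊥
  disjoint (v∈- , here refl) with x , x∈ , 0≡-x ← ∈-map⁻ ℤ.-_ v∈- =
    contradiction (subst (1 ℕ.≤_) (≡.trans (≡.sym (ℤ.∣-i∣≡∣i∣ x)) (cong ∣_∣ (≡.sym 0≡-x))) (All.lookup w≢0 x∈)) λ ()
  disjoint (v∈- , there v∈) with x , x∈ , refl ← ∈-map⁻ ℤ.-_ v∈- =
    -x≢x {x} (All.lookup w≢0 x∈) (unique-∣∣ w! v∈ x∈ (ℤ.∣-i∣≡∣i∣ x))

-- The central 0 keeps 0 out of `w`. Letters of equal absolute value are equal or opposite: the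
-- first is excluded by uniqueness within `w`, the second by disjointness of `w` from its negatives.
oddExtension-Unique⁻ : ∀ w → Unique (oddExtension w) → All ((1 ℕ.≤_) ∘ ∣_∣) w × Distinct w
oddExtension-Unique⁻ w ext! = All.map 1≤∣∣ (AllPairs.head 0∷w!) , distinct′ w (AllPairs.tail 0∷w!) (λ x∈ → -x∉w x∈)
  where
  ++⁻ : ∀ {A : Set} (xs : List A) {ys} → Unique (xs ++ ys) → Unique ys × (∀ {v} → v ∈ xs → v ∈ ys → ⊥)
  ++⁻ []       ys!         = ys! , λ ()
  ++⁻ (x ∷ xs) (x≢ ∷ rest) = let ys! , disj = ++⁻ xs rest in ys! ,
    λ { (here refl) v∈ → All.lookup (All.++⁻ʳ xs x≢) v∈ refl ; (there v∈) → disj v∈ }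
  split = ++⁻ (map ℤ.-_ w) (↭ₛ.Unique-resp-↭ (≡.setoid ℤ) (↭⇒↭ₛ (oddExtension-↭ w)) ext!)
  0∷w! : Unique (0ℤ ∷ w)
  0∷w! = proj₁ split
  -x∉w : ∀ {x} → x ∈ w → ¬ ℤ.- x ∈ w
  -x∉w x∈ -x∈ = proj₂ split (∈-map⁺ ℤ.-_ x∈) (there -x∈)
  1≤∣∣ : ∀ {x} → 0ℤ ≢ x → 1 ℕ.≤ ∣ x ∣
  1≤∣∣ {+ zero}     0≢x = contradiction refl 0≢x
  1≤∣∣ {+ suc _}    _   = s≤s z≤n
  1≤∣∣ { -[1+ _ ] } _   = s≤s z≤n
  distinct′ : ∀ v → Unique v → (∀ {x} → x ∈ v → ¬ ℤ.- x ∈ v) → Distinct v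
  distinct′ []      []        _    = []
  distinct′ (x ∷ v) (x≢ ∷ v!) -x∉v = All.tabulate x≁ ∷ distinct′ v v! (λ z∈ -z∈ → -x∉v (there z∈) (there -z∈))
    where
    x≁ : ∀ {z} → z ∈ v → ∣ x ∣ ≢ ∣ z ∣
    x≁ {z} z∈ e with ∣x∣≡∣z∣⇒ x z e
    ... | inj₁ refl = All.lookup x≢ z∈ refl
    ... | inj₂ refl = -x∉v (here refl) (there z∈)

𝔅-Enumerates : ∀ n → Enumerates (λ _ → ⊤) n (𝔅 n)
𝔅-Enumerates n = record
  { unique = Unique.filter⁺ _ (words-Unique (Unique.map⁺ shift-injective (Unique.upTo⁺ _)) n)
  ; member = mk⇔ to from
  }
  where
  shift : ℕ → ℤ
  shift k = + k ℤ.- + n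
  letters : List ℤ
  letters = map shift (upTo (suc (2 ℕ.* n)))
  shift-injective : ∀ {j k} → shift j ≡ shift k → j ≡ k
  shift-injective {j} {k} e = ℤ.+-injective (AbelianGroupProperties.∙-cancelʳ ℤ.+-0-abelianGroup (ℤ.- + n) (+ j) (+ k) e)
  2n≡n+n : 2 ℕ.* n ≡ n ℕ.+ n
  2n≡n+n = cong (n ℕ.+_) (ℕ.+-identityʳ n)
  letter⁻ : ∀ {x} → x ∈ letters → ∣ x ∣ ℕ.≤ n
  letter⁻ x∈ with k , k∈ , refl ← ∈-map⁻ shift x∈ rewrite ℤ.m-n≡m⊖n k n with ℕ.≤-total k n
  ... | inj₁ k≤n = ℕ.≤-trans (ℕ.≤-reflexive (ℤ.∣⊖∣-≤ k≤n)) (ℕ.m∸n≤m n k)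
  ... | inj₂ n≤k = ℕ.≤-trans (ℕ.≤-reflexive (cong ∣_∣ (ℤ.⊖-≥ n≤k)))
    (ℕ.≤-trans (ℕ.∸-monoˡ-≤ n (subst (k ℕ.≤_) 2n≡n+n (ℕ.≤-pred (∈-upTo⁻ k∈))))
               (ℕ.≤-reflexive (ℕ.m+n∸m≡n n n)))
  letter⁺ : ∀ {x} → ∣ x ∣ ℕ.≤ n → x ∈ letters
  -- The index of `x` is `x + n`, which is nonnegative and hence its own absolute value.
  letter⁺ {x} ∣x∣≤n = subst (_∈ letters) shift-k≡x (∈-map⁺ shift (∈-upTo⁺ (s≤s k≤2n)))
    where
    0≤x+n : 0ℤ ℤ.≤ x ℤ.+ + n
    0≤x+n = subst (ℤ._≤ x ℤ.+ + n) (ℤ.+-inverseˡ (+ n)) (ℤ.+-monoˡ-≤ (+ n) (-n≤x x ∣x∣≤n))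
      where
      -n≤x : ∀ x → ∣ x ∣ ℕ.≤ n → ℤ.- + n ℤ.≤ x
      -n≤x (+ _)      _   = ℤ.≤-trans (ℤ.neg-mono-≤ (ℤ.+≤+ z≤n)) (ℤ.+≤+ z≤n)
      -n≤x (-[1+ k ]) k<n = ℤ.neg-mono-≤ (ℤ.+≤+ k<n)
    k≤2n : ∣ x ℤ.+ + n ∣ ℕ.≤ 2 ℕ.* n
    k≤2n = ℕ.≤-trans (ℤ.∣i+j∣≤∣i∣+∣j∣ x (+ n))
      (ℕ.≤-trans (ℕ.+-monoˡ-≤ n ∣x∣≤n) (ℕ.≤-reflexive (≡.sym 2n≡n+n)))
    shift-k≡x : shift ∣ x ℤ.+ + n ∣ ≡ x
    shift-k≡x = begin
      + ∣ x ℤ.+ + n ∣ ℤ.- + n ≡⟨ cong (ℤ._- + n) (ℤ.0≤i⇒+∣i∣≡i 0≤x+n) ⟩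
      x ℤ.+ + n ℤ.- + n       ≡⟨ ℤ.+-assoc x (+ n) (ℤ.- + n) ⟩
      x ℤ.+ (+ n ℤ.- + n)     ≡⟨ cong (λ z → x ℤ.+ z) (ℤ.+-inverseʳ (+ n)) ⟩
      x ℤ.+ 0ℤ                ≡⟨ ℤ.+-identityʳ x ⟩
      x                       ∎
      where open ≡.≡-Reasoning
  to : ∀ {w} → w ∈ 𝔅 n → Arrangement n w × All (λ _ → ⊤) w
  to {w} w∈ =
    let w∈words , ext! = ∈-filter⁻ _ {xs = words letters n} w∈
        l , w⊆ = ∈-words⁻ n w∈words
        w≢0 , w! = oddExtension-Unique⁻ w ext!
    in arrangement l (All.zip (w≢0 , All.map letter⁻ w⊆)) w! , All.universal (λ _ → tt) w
  from : ∀ {w} → Arrangement n w × All (λ _ → ⊤) w → w ∈ 𝔅 n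
  from (arrangement refl r w! , _) = ∈-filter⁺ _
    (∈-words⁺ (All.map (letter⁺ ∘ proj₂) r))
    (oddExtension-Unique⁺ (All.map proj₁ r) w!)

-- Evaluation in a commutative ring.

module Evaluation {c ℓ} (R : CommutativeRing c ℓ) (y₀ t₀ : CommutativeRing.Carrier R) where
  open CommutativeRing R renaming (refl to ≈-refl)

  -- Setting `𝐚` to 1 has to wait until after differentiation: `D 𝟙` is `𝟘` while `D 𝐚` is not, so
  -- `D` is in general incompatible with this evaluation.
  ⟦_⟧ : Poly → Carrier
  ⟦ 𝐲 ⟧     = y₀
  ⟦ 𝐚 ⟧     = 1#
  ⟦ 𝐝 ⟧     = t₀
  ⟦ 𝟘 ⟧     = 0#
  ⟦ 𝟙 ⟧     = 1#
  ⟦ f ⊕ g ⟧ = ⟦ f ⟧ + ⟦ g ⟧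
  ⟦ f ⊗ g ⟧ = ⟦ f ⟧ * ⟦ g ⟧

  ⟦⟧-cong : ∀ {f g} → f ≋ g → ⟦ f ⟧ ≈ ⟦ g ⟧
  ⟦⟧-cong ≋-refl               = ≈-refl
  ⟦⟧-cong (≋-sym p)            = sym (⟦⟧-cong p)
  ⟦⟧-cong (≋-trans p q)        = trans (⟦⟧-cong p) (⟦⟧-cong q)
  ⟦⟧-cong (⊕-cong p q)         = +-cong (⟦⟧-cong p) (⟦⟧-cong q)
  ⟦⟧-cong (⊕-assoc f g h)      = +-assoc _ _ _
  ⟦⟧-cong (⊕-comm f g)         = +-comm _ _
  ⟦⟧-cong (⊕-identityˡ f)      = +-identityˡ _
  ⟦⟧-cong (⊗-cong p q)         = *-cong (⟦⟧-cong p) (⟦⟧-cong q)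
  ⟦⟧-cong (⊗-assoc f g h)      = *-assoc _ _ _
  ⟦⟧-cong (⊗-comm f g)         = *-comm _ _
  ⟦⟧-cong (⊗-identityˡ f)      = *-identityˡ _
  ⟦⟧-cong (⊗-distribʳ-⊕ f g h) = distribʳ _ _ _
  ⟦⟧-cong (⊗-zeroˡ f)          = zeroˡ _

-- The common recursion of the two sums.

module _ {S : ℤ → Set} {n : ℕ} {L : List ℤ}
         (L! : Unique L) (L-member : ∀ {x} → x ∈ L ⇔ (∣ x ∣ ≡ suc n × S x)) where
  -- Every word of size `suc n` arises from exactly one insertion into a word of size `n`, so the
  -- identity for a single word sums up to the recursion, `T` being additive.
  ∑-suc : ∀ {𝔏 𝔏⁺} f → Enumerates S n 𝔏 → Enumerates S (suc n) 𝔏⁺ →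
    (∀ {w} → All (Below (suc n)) w → ∑ (insertAll L w) f ≋ T (f w)) → ∑ 𝔏⁺ f ≋ T (∑ 𝔏 f)
  ∑-suc {𝔏} {𝔏⁺} f E E⁺ ∑≋T = begin
    ∑ 𝔏⁺ f                            ≈⟨ ∑-↭ f (Enumerates-↭ E⁺ (Enumerates-insertAll L! L-member E)) ⟩
    ∑ (concatMap (insertAll L) 𝔏) f   ≈⟨ ∑-concatMap 𝔏 (insertAll L) f ⟩
    ∑ 𝔏 (λ w → ∑ (insertAll L w) f)   ≈⟨ ∑-cong 𝔏 (λ w∈ → ∑≋T (All.map (s≤s ∘ proj₂)
                                           (range (proj₁ (Equivalence.to (member E) w∈))))) ⟩
    ∑ 𝔏 (T ∘ f)                       ≈⟨ ∑-T 𝔏 f ⟩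
    T (∑ 𝔏 f)                         ∎
    where open SetoidReasoning K.setoid

-- The leading `0ℤ` lies below every letter, so left peaks become ordinary peaks of `0 π₁ ⋯ πₙ`.
∑-𝔖-suc : ∀ n → ∑ (𝔖 (suc n)) (ω↓ 0ℤ) ≋ T (∑ (𝔖 n) (ω↓ 0ℤ))
∑-𝔖-suc n = ∑-suc ([] ∷ []) (mk⇔ to from) (ω↓ 0ℤ) (𝔖-Enumerates n) (𝔖-Enumerates (suc n))
  λ {w} w<M → ≋-trans (∑-++ (insertions (+ suc n) w) [] (ω↓ 0ℤ))
    (≋-trans (K.+-identityʳ _) (∑-insertions-ω↓ n 0ℤ w (s≤s z≤n) w<M))
  where
  to : ∀ {x} → x ∈ + suc n ∷ [] → ∣ x ∣ ≡ suc n × Positive x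
  to (here refl) = refl , ℤ.+<+ (s≤s z≤n)
  from : ∀ {x} → ∣ x ∣ ≡ suc n × Positive x → x ∈ + suc n ∷ []
  from {+ _} (refl , _) = here refl

∑-𝔅-suc : ∀ n → ∑ (𝔅 (suc n)) (β 0ℤ) ≋ T (∑ (𝔅 n) (β 0ℤ))
∑-𝔅-suc n = ∑-suc (((λ ()) ∷ []) ∷ [] ∷ []) (mk⇔ to from) (β 0ℤ) (𝔅-Enumerates n) (𝔅-Enumerates (suc n))
  λ {w} w<M → ≋-trans (∑-concatMap (+ suc n ∷ ℤ.- + suc n ∷ []) (λ x → insertions x w) (β 0ℤ))
    (≋-trans (⊕-cong ≋-refl (K.+-identityʳ _)) (∑-insertions-β n 0ℤ w (s≤s z≤n) w<M))
  where
  to : ∀ {x} → x ∈ + suc n ∷ ℤ.- + suc n ∷ [] → ∣ x ∣ ≡ suc n × ⊤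
  to (here refl)         = refl , tt
  to (there (here refl)) = refl , tt
  from : ∀ {x} → ∣ x ∣ ≡ suc n × ⊤ → x ∈ + suc n ∷ ℤ.- + suc n ∷ []
  from {+ _}        (refl , _) = here refl
  from { -[1+ _ ] } (refl , _) = there (here refl)

∑-𝔅≋∑-𝔖 : ∀ n → ∑ (𝔅 n) (β 0ℤ) ≋ ∑ (𝔖 n) (ω↓ 0ℤ)
∑-𝔅≋∑-𝔖 zero    = ≋-refl
∑-𝔅≋∑-𝔖 (suc n) =
  ≋-trans (∑-𝔅-suc n) (≋-trans (T-cong (∑-𝔅≋∑-𝔖 n)) (≋-sym (∑-𝔖-suc n)))

-- Statistics read off from the weights, and the first identity.

≮ᵇ⇒>ᵇ : ∀ {c x} → c ≢ x → (x <ᵇ c) ≡ false → (c <ᵇ x) ≡ true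
≮ᵇ⇒>ᵇ {c} {x} c≢x x≮c = <⇒<ᵇ (ℤ.≤∧≢⇒< (ℤ.≮⇒≥ λ x<c →
  contradiction (≡.trans (≡.sym (<⇒<ᵇ x<c)) x≮c) λ ()) c≢x)

<ᵇ-asym : ∀ {c x} → (x <ᵇ c) ≡ true → (c <ᵇ x) ≡ false
<ᵇ-asym {c} {x} x<ᵇc with x ℤ.<? c
... | yes x<c = ≮⇒<ᵇ (ℤ.<-asym x<c)

interiorPeaks-descent : ∀ c x w → (x <ᵇ c) ≡ true →
  interiorPeaks (c ∷ x ∷ w) ≡ interiorPeaks (x ∷ w)
interiorPeaks-descent c x []      x<c = refl
interiorPeaks-descent c x (z ∷ w) x<c rewrite <ᵇ-asym {c} {x} x<c = refl

-- After an ascent into `x`, an immediate descent makes `x` a peak; this is the case that `lpk` adds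
-- to `interiorPeaks`.
interiorPeaks-ascent : ∀ c x w → (c <ᵇ x) ≡ true → interiorPeaks (c ∷ x ∷ w) ≡ lpk (x ∷ w)
interiorPeaks-ascent c x []      c<x = refl
interiorPeaks-ascent c x (z ∷ w) c<x rewrite c<x = refl

module _ {c ℓ} (R : CommutativeRing c ℓ) where
  open CommutativeRing R renaming (refl to ≈-refl)
  open Exp semiring using (_^_)
  open SetoidReasoning setoid
  private
    module ∑ᴿ = Sums commutativeSemiring
  open Solver commutativeSemiring using (solve; _:=_; _:+_; _:*_; con)

  module _ (y t y′ t′ : Carrier)
           (t′-eq : t′ * (1# + y * t) ≈ y + t)
           (y′-eq : y′ * ((y + t) * (1# + y * t)) ≈ (1# + y) ^ 2 * t) where
    open Evaluation R y t

    ⟦∑⟧ : ∀ {i} {A : Set i} (xs : List A) f → ⟦ ∑ xs f ⟧ ≡ ∑ᴿ.∑ xs (⟦_⟧ ∘ f)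
    ⟦∑⟧ []       f = refl
    ⟦∑⟧ (x ∷ xs) f = cong (λ s → ⟦ f x ⟧ + s) (⟦∑⟧ xs f)

    ⟦sign⟧ : ∀ x w → ⟦ sign x ⟧ * y ^ neg w ≈ y ^ neg (x ∷ w)
    ⟦sign⟧ x w with x ℤ.<? 0ℤ
    ... | yes _ = ≈-refl
    ... | no  _ = *-identityˡ _

    ⟦step⟧ : ∀ c x w → ⟦ step c x ⟧ * t ^ des (x ∷ w) ≈ t ^ des (c ∷ x ∷ w)
    ⟦step⟧ c x w with x <ᵇ c
    ... | true  = ≈-refl
    ... | false = *-identityˡ _

    ⟦β⟧ : ∀ c w → ⟦ β c w ⟧ ≈ y ^ neg w * t ^ des (c ∷ w)
    ⟦β⟧ c []      = sym (*-identityˡ 1#)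
    ⟦β⟧ c (x ∷ w) = begin
      ⟦ sign x ⟧ * ⟦ step c x ⟧ * ⟦ β x w ⟧
        ≈⟨ *-congˡ (⟦β⟧ x w) ⟩
      ⟦ sign x ⟧ * ⟦ step c x ⟧ * (y ^ neg w * t ^ des (x ∷ w))
        ≈⟨ solve 4 (λ s r y t → s :* r :* (y :* t) := s :* y :* (r :* t)) ≈-refl _ _ _ _ ⟩
      ⟦ sign x ⟧ * y ^ neg w * (⟦ step c x ⟧ * t ^ des (x ∷ w))
        ≈⟨ *-cong (⟦sign⟧ x w) (⟦step⟧ c x w) ⟩
      y ^ neg (x ∷ w) * t ^ des (c ∷ x ∷ w) ∎

    private
      A : Carrier
      A = 1# + y * t

      ⟦δ⟧ : ⟦ δ ⟧ ≈ t′ * A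
      ⟦δ⟧ = trans (solve 2 (λ y t → t :+ y :* con 1 := y :+ t) ≈-refl y t) (sym t′-eq)

      ⟦p⟧ : ⟦ p ⟧ ≈ y′ * (t′ * A * A)
      ⟦p⟧ = begin
        (1# + y) * (1# + y) * 1# * t
          ≈⟨ solve 2 (λ q t → q :* q :* con 1 :* t := q :* (q :* con 1) :* t) ≈-refl (1# + y) t ⟩
        (1# + y) ^ 2 * t         ≈⟨ y′-eq ⟨
        y′ * ((y + t) * A)       ≈⟨ *-congˡ (*-congʳ t′-eq) ⟨
        y′ * (t′ * A * A)        ∎

    -- `α`, `δ` and `p` evaluate to `A`, `t′ * A` and `y′ * (t′ * A * A)`: each step contributes
    -- `A`, each descent `t′`, each peak `y′`. In `ω↑` the ascent into `c` is still outstanding,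
    -- whence the additional `A` and `lpk` in place of `interiorPeaks`. `Linked` makes every
    -- non-descent an ascent.
    ⟦ω↓⟧ : ∀ c w → Linked _≢_ (c ∷ w) →
      ⟦ ω↓ c w ⟧ ≈ A ^ length w * (y′ ^ interiorPeaks (c ∷ w) * t′ ^ des (c ∷ w))
    ⟦ω↑⟧ : ∀ c w → Linked _≢_ (c ∷ w) →
      ⟦ ω↑ c w ⟧ ≈ A ^ suc (length w) * (y′ ^ lpk (c ∷ w) * t′ ^ des (c ∷ w))
    ⟦ω↓⟧ c []      _          = sym (trans (*-identityˡ _) (*-identityˡ _))
    ⟦ω↓⟧ c (x ∷ w) (c≢x ∷ w≢) with x <ᵇ c in x<c
    ... | true rewrite interiorPeaks-descent c x w x<c = begin
      ⟦ δ ⟧ * ⟦ ω↓ x w ⟧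
        ≈⟨ *-cong ⟦δ⟧ (⟦ω↓⟧ x w w≢) ⟩
      t′ * A * (A ^ length w * (y′ ^ interiorPeaks (x ∷ w) * t′ ^ des (x ∷ w)))
        ≈⟨ solve 5 (λ t a l k e → t :* a :* (l :* (k :* e)) := a :* l :* (k :* (t :* e)))
             ≈-refl _ _ _ _ _ ⟩
      A * A ^ length w * (y′ ^ interiorPeaks (x ∷ w) * (t′ * t′ ^ des (x ∷ w))) ∎
    ... | false rewrite interiorPeaks-ascent c x w (≮ᵇ⇒>ᵇ c≢x x<c) = ⟦ω↑⟧ x w w≢
    ⟦ω↑⟧ c []      _          = solve 2
      (λ y t → con 1 :+ y :* t := (con 1 :+ y :* t) :* con 1 :* (con 1 :* con 1)) ≈-refl y t
    ⟦ω↑⟧ c (x ∷ w) (c≢x ∷ w≢) with x <ᵇ c in x<c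
    ... | true rewrite interiorPeaks-descent c x w x<c = begin
      ⟦ p ⟧ * ⟦ ω↓ x w ⟧
        ≈⟨ *-cong ⟦p⟧ (⟦ω↓⟧ x w w≢) ⟩
      y′ * (t′ * A * A) * (A ^ length w * (y′ ^ interiorPeaks (x ∷ w) * t′ ^ des (x ∷ w)))
        ≈⟨ solve 6 (λ y t a l k e →
             y :* (t :* a :* a) :* (l :* (k :* e)) := a :* (a :* l) :* (y :* k :* (t :* e)))
             ≈-refl _ _ _ _ _ _ ⟩
      A * (A * A ^ length w) * (y′ * y′ ^ interiorPeaks (x ∷ w) * (t′ * t′ ^ des (x ∷ w))) ∎
    ... | false rewrite interiorPeaks-ascent c x w (≮ᵇ⇒>ᵇ c≢x x<c) =
      trans (*-congˡ (⟦ω↑⟧ x w w≢)) (sym (*-assoc _ _ _))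

    private
      ⟦ω↓⟧-𝔖 : ∀ n {π} → π ∈ 𝔖 n → ⟦ ω↓ 0ℤ π ⟧ ≈ A ^ n * (y′ ^ lpk π * t′ ^ des π)
      ⟦ω↓⟧-𝔖 n {π} π∈ = go π (Equivalence.to (member (𝔖-Enumerates n)) π∈)
        where
        go : ∀ π → Arrangement n π × All Positive π → ⟦ ω↓ 0ℤ π ⟧ ≈ A ^ n * (y′ ^ lpk π * t′ ^ des π)
        go []      (arrangement refl _ _ , _) = sym (trans (*-identityˡ _) (*-identityˡ _))
        go (x ∷ w) (arrangement refl _ w! , 0<x ∷ _) rewrite ≮⇒<ᵇ (ℤ.<-asym 0<x) =
          ⟦ω↑⟧ x w (AllPairs⇒Linked (AllPairs.map (_∘ cong ∣_∣) w!))

    -- With `y′` and `t′` given by cross-multiplied equations, this serves both directions: `y`, `t`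
    -- may be the indeterminates, or they may be the quotients `u`, `v` with the indeterminates as
    -- `y′`, `t′`.
    B≈P⟨lpk,des⟩ : ∀ n → B R n y t ≈ (1# + y * t) ^ n * P⟨lpk,des⟩ R n y′ t′
    B≈P⟨lpk,des⟩ n = begin
      B R n y t                      ≈⟨ ∑ᴿ.∑-cong (𝔅 n) (λ {π} _ → ⟦β⟧ 0ℤ π) ⟨
      ∑ᴿ.∑ (𝔅 n) (⟦_⟧ ∘ β 0ℤ)        ≡⟨ ⟦∑⟧ (𝔅 n) (β 0ℤ) ⟨
      ⟦ ∑ (𝔅 n) (β 0ℤ) ⟧             ≈⟨ ⟦⟧-cong (∑-𝔅≋∑-𝔖 n) ⟩
      ⟦ ∑ (𝔖 n) (ω↓ 0ℤ) ⟧            ≡⟨ ⟦∑⟧ (𝔖 n) (ω↓ 0ℤ) ⟩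
      ∑ᴿ.∑ (𝔖 n) (⟦_⟧ ∘ ω↓ 0ℤ)       ≈⟨ ∑ᴿ.∑-cong (𝔖 n) (⟦ω↓⟧-𝔖 n) ⟩
      ∑ᴿ.∑ (𝔖 n) (λ π → A ^ n * (y′ ^ lpk π * t′ ^ des π))
                                     ≈⟨ ∑ᴿ.∑-* (𝔖 n) (A ^ n) _ ⟩
      A ^ n * P⟨lpk,des⟩ R n y′ t′   ∎

-- Factorisations coming from the square root.

module Radical {c ℓ} (R : IntegralDomain c ℓ) where
  open IntegralDomain R renaming (refl to ≈-refl)
  open GroupProperties +-group using (∙-cancelʳ; //-rightDividesˡ)
  open Solver commutativeSemiring using (solve; _:=_; _:+_; _:*_; con)
  open SetoidReasoning setoid

  module Root (y t ρ : Carrier) (ρ-square : ρ * ρ ≈ (1# + t) ^ 2 - (1# + 1#) * (1# + 1#) * y * t) where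
    private
      2# f z N₁ N₂ : Carrier
      2# = 1# + 1#
      f  = 2# * y * t
      z  = 1# - y
      N₁ = 1# + t ^ 2 - 2# * y * t - (1# - t) * ρ
      N₂ = (1# + t) ^ 2 - 2# * y * t - (1# + t) * ρ

    -- Put X = ρ + b and W = ρ + 1 + t.  As 2 N₁ = P² and 4 (1 - y) t = P X, while 2 N₂ = Q² and
    -- 4 y t = Q W, the series u and v of the theorem are P / X and Q / W.  Both X and W are
    -- written as sums of b, P and Q, so that what is left to check are semiring identities.
    b P Q : Carrier
    b = 1# - t
    P = ρ - b
    Q = (1# + t) - ρ

    private
      -- The identities below are proved with the subtracted terms added back to both sides and
      -- cancelled at the end.
      minus : ∀ x z → x - z + z ≈ x
      minus x z = //-rightDividesˡ z x

      minus₂ : ∀ x z w → x - z - w + (z + w) ≈ x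
      minus₂ x z w = trans (solve 3 (λ u z w → u :+ (z :+ w) := (u :+ w) :+ z) ≈-refl (x - z - w) z w)
        (trans (+-congʳ (minus (x - z) w)) (minus x z))

      1≈ : 1# ≈ b + t
      1≈ = sym (minus 1# t)
      ρ≈ : ρ ≈ P + b
      ρ≈ = sym (minus ρ b)
      1+t≈Q+ρ : 1# + t ≈ Q + ρ
      1+t≈Q+ρ = sym (minus (1# + t) ρ)
      1+t≈b+t+t : 1# + t ≈ b + t + t
      1+t≈b+t+t = +-congʳ 1≈
      ρ²≈ : ρ * ρ + (f + f) ≈ (1# + t) * (1# + t)
      ρ²≈ = begin
        ρ * ρ + (f + f)
          ≈⟨ +-cong ρ-square (solve 2 (λ y t → let two = con 1 :+ con 1 in
               two :* y :* t :+ two :* y :* t := two :* two :* y :* t) ≈-refl y t) ⟩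
        (1# + t) ^ 2 - 2# * 2# * y * t + 2# * 2# * y * t ≈⟨ minus _ _ ⟩
        (1# + t) ^ 2                                     ≈⟨ *-congˡ (*-identityʳ _) ⟩
        (1# + t) * (1# + t)                              ∎

    b+b+P+Q≈2 : b + b + P + Q ≈ 2#
    b+b+P+Q≈2 = begin
      b + b + P + Q   ≈⟨ solve 3 (λ b p q → b :+ b :+ p :+ q := b :+ (q :+ (p :+ b))) ≈-refl b P Q ⟩
      b + (Q + (P + b)) ≈⟨ +-congˡ (trans 1+t≈Q+ρ (+-congˡ ρ≈)) ⟨
      b + (1# + t)    ≈⟨ solve 2 (λ b t → b :+ (con 1 :+ t) := con 1 :+ (b :+ t)) ≈-refl b t ⟩
      1# + (b + t)    ≈⟨ +-congˡ 1≈ ⟨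
      2#              ∎

    t+t≈P+Q : t + t ≈ P + Q
    t+t≈P+Q = ∙-cancelʳ b _ _ (begin
      t + t + b     ≈⟨ solve 2 (λ b t → t :+ t :+ b := b :+ t :+ t) ≈-refl b t ⟩
      b + t + t     ≈⟨ 1+t≈b+t+t ⟨
      1# + t        ≈⟨ trans 1+t≈Q+ρ (+-congˡ ρ≈) ⟩
      Q + (P + b)   ≈⟨ solve 3 (λ b p q → q :+ (p :+ b) := p :+ q :+ b) ≈-refl b P Q ⟩
      P + Q + b     ∎)

    -- The difference of squares `(1 + t)² - ρ²`: the second factor is `1 + t + ρ`.
    4yt≈QW : f + f ≈ Q * (b + b + P + P + Q)
    4yt≈QW = ∙-cancelʳ (ρ * ρ) _ _ (begin
      f + f + ρ * ρ     ≈⟨ trans (+-comm _ _) ρ²≈ ⟩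
      (1# + t) * (1# + t)  ≈⟨ *-cong 1+t≈Q+ρ 1+t≈Q+ρ ⟩
      (Q + ρ) * (Q + ρ) ≈⟨ solve 2 (λ q r → (q :+ r) :* (q :+ r) := q :* (r :+ r :+ q) :+ r :* r) ≈-refl Q ρ ⟩
      Q * (ρ + ρ + Q) + ρ * ρ ≈⟨ +-congʳ (*-congˡ (+-congʳ (+-cong ρ≈ ρ≈))) ⟩
      Q * (P + b + (P + b) + Q) + ρ * ρ
        ≈⟨ +-congʳ (*-congˡ (solve 3 (λ b p q → p :+ b :+ (p :+ b) :+ q := b :+ b :+ p :+ p :+ q) ≈-refl b P Q)) ⟩
      Q * (b + b + P + P + Q) + ρ * ρ ∎)

    -- From `2 (1 + t²) = (1 - t)² + (1 + t)²` and `(1 + t)² - 4 y t = ρ²`, twice `N₁` is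
    -- `b² + ρ² - 2 b ρ`.
    2N₁≈P² : N₁ + N₁ ≈ P * P
    -- `s` collects the subtracted terms of `N₁`; `ρ * ρ` is added because `ρ²≈` brings it in
    -- together with `f + f`.
    2N₁≈P² = ∙-cancelʳ (s + s + ρ * ρ) _ _ (begin
      N₁ + N₁ + (s + s + ρ * ρ)
        ≈⟨ solve 3 (λ n s r → n :+ n :+ (s :+ s :+ r) := (n :+ s) :+ (n :+ s) :+ r) ≈-refl N₁ s (ρ * ρ) ⟩
      (N₁ + s) + (N₁ + s) + ρ * ρ
        ≈⟨ +-cong (+-cong N₁+s N₁+s) (*-cong ρ≈ ρ≈) ⟩
      ((b + t) * (b + t) + t * t) + ((b + t) * (b + t) + t * t) + (P + b) * (P + b)
        ≈⟨ solve 3 (λ b t p → ((b :+ t) :* (b :+ t) :+ t :* t) :+ ((b :+ t) :* (b :+ t) :+ t :* t)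
             :+ (p :+ b) :* (p :+ b) := p :* p :+ (b :* (p :+ b) :+ b :* (p :+ b))
               :+ (b :+ t :+ t) :* (b :+ t :+ t)) ≈-refl b t P ⟩
      P * P + (b * (P + b) + b * (P + b)) + (b + t + t) * (b + t + t)
        ≈⟨ +-cong (+-congˡ (+-cong (*-congˡ ρ≈) (*-congˡ ρ≈))) (*-cong 1+t≈b+t+t 1+t≈b+t+t) ⟨
      P * P + (b * ρ + b * ρ) + (1# + t) * (1# + t)
        ≈⟨ +-congˡ ρ²≈ ⟨
      P * P + (b * ρ + b * ρ) + (ρ * ρ + (f + f))
        ≈⟨ solve 4 (λ p c r f → p :+ (c :+ c) :+ (r :+ (f :+ f)) := p :+ ((f :+ c) :+ (f :+ c) :+ r))
             ≈-refl (P * P) (b * ρ) (ρ * ρ) f ⟩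
      P * P + (s + s + ρ * ρ) ∎)
      where
      s : Carrier
      s = f + b * ρ
      N₁+s : N₁ + s ≈ (b + t) * (b + t) + t * t
      N₁+s = trans (minus₂ _ _ _) (+-cong
        (trans (sym (*-identityʳ 1#)) (*-cong 1≈ 1≈)) (*-congˡ (*-identityʳ t)))

    -- Likewise, twice `N₂` is `(1 + t)² + ρ² - 2 (1 + t) ρ`.
    2N₂≈Q² : N₂ + N₂ ≈ Q * Q
    2N₂≈Q² = ∙-cancelʳ (s + s + ρ * ρ) _ _ (begin
      N₂ + N₂ + (s + s + ρ * ρ)
        ≈⟨ solve 3 (λ n s r → n :+ n :+ (s :+ s :+ r) := (n :+ s) :+ (n :+ s) :+ r) ≈-refl N₂ s (ρ * ρ) ⟩
      (N₂ + s) + (N₂ + s) + ρ * ρ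
        ≈⟨ +-congʳ (+-cong N₂+s N₂+s) ⟩
      (Q + ρ) * (Q + ρ) + (Q + ρ) * (Q + ρ) + ρ * ρ
        ≈⟨ solve 2 (λ q r → (q :+ r) :* (q :+ r) :+ (q :+ r) :* (q :+ r) :+ r :* r :=
             q :* q :+ ((q :+ r) :* r :+ (q :+ r) :* r) :+ (q :+ r) :* (q :+ r)) ≈-refl Q ρ ⟩
      Q * Q + ((Q + ρ) * ρ + (Q + ρ) * ρ) + (Q + ρ) * (Q + ρ)
        ≈⟨ +-cong (+-congˡ (+-cong (*-congʳ 1+t≈Q+ρ) (*-congʳ 1+t≈Q+ρ))) (*-cong 1+t≈Q+ρ 1+t≈Q+ρ) ⟨
      Q * Q + ((1# + t) * ρ + (1# + t) * ρ) + (1# + t) * (1# + t)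
        ≈⟨ +-congˡ ρ²≈ ⟨
      Q * Q + ((1# + t) * ρ + (1# + t) * ρ) + (ρ * ρ + (f + f))
        ≈⟨ solve 4 (λ p c r f → p :+ (c :+ c) :+ (r :+ (f :+ f)) := p :+ ((f :+ c) :+ (f :+ c) :+ r))
             ≈-refl (Q * Q) ((1# + t) * ρ) (ρ * ρ) f ⟩
      Q * Q + (s + s + ρ * ρ) ∎)
      where
      s : Carrier
      s = f + (1# + t) * ρ
      N₂+s : N₂ + s ≈ (Q + ρ) * (Q + ρ)
      N₂+s = trans (minus₂ _ _ _) (trans (*-congˡ (*-identityʳ _)) (*-cong 1+t≈Q+ρ 1+t≈Q+ρ))

    -- The difference of squares `ρ² - b²`, where `ρ² = (1 + t)² - 4 y t` and
    -- `(1 + t)² - (1 - t)² = 4 t`.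
    4[1-y]t≈PX : 2# * (1# - y) * t + 2# * (1# - y) * t ≈ P * (b + b + P)
    4[1-y]t≈PX = ∙-cancelʳ (b * b + (f + f)) _ _ (begin
      2# * z * t + 2# * z * t + (b * b + (f + f))
        ≈⟨ solve 4 (λ z t b y → let two = con 1 :+ con 1 in
             two :* z :* t :+ two :* z :* t :+ (b :* b :+ (two :* y :* t :+ two :* y :* t)) :=
             (t :+ t) :* ((z :+ y) :+ (z :+ y)) :+ b :* b) ≈-refl z t b y ⟩
      (t + t) * ((z + y) + (z + y)) + b * b
        ≈⟨ +-congʳ (*-congˡ (+-cong z+y z+y)) ⟩
      (t + t) * ((b + t) + (b + t)) + b * b
        ≈⟨ solve 2 (λ b t → (t :+ t) :* ((b :+ t) :+ (b :+ t)) :+ b :* b :=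
             (b :+ t :+ t) :* (b :+ t :+ t)) ≈-refl b t ⟩
      (b + t + t) * (b + t + t) ≈⟨ *-cong 1+t≈b+t+t 1+t≈b+t+t ⟨
      (1# + t) * (1# + t)       ≈⟨ ρ²≈ ⟨
      ρ * ρ + (f + f)           ≈⟨ +-congʳ (*-cong ρ≈ ρ≈) ⟩
      (P + b) * (P + b) + (f + f)
        ≈⟨ solve 3 (λ p b f → (p :+ b) :* (p :+ b) :+ f := p :* (b :+ b :+ p) :+ (b :* b :+ f)) ≈-refl P b (f + f) ⟩
      P * (b + b + P) + (b * b + (f + f)) ∎)
      where
      z+y : z + y ≈ b + t
      z+y = trans (minus 1# y) 1≈

    module _ (q₁≉0 : ¬ 2# * (1# - y) * t ≈ 0#) (q₂≉0 : ¬ 2# * y * t ≈ 0#) where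
      private
        2≉0 : ¬ 2# ≈ 0#
        2≉0 2≈0 = q₂≉0 (trans (*-congʳ (trans (*-congʳ 2≈0) (zeroˡ y))) (zeroˡ t))

        double : ∀ x → 2# * x ≈ x + x
        double x = solve 1 (λ x → (con 1 :+ con 1) :* x := x :+ x) ≈-refl x

        double≉0 : ∀ {x} → ¬ x ≈ 0# → ¬ x + x ≈ 0#
        double≉0 x≉0 x+x≈0 = *-≉0 2≉0 x≉0 (trans (double _) x+x≈0)

        -- The common factor `g` of `2 n` and `2 q` reduces the fraction `n / q` to `g / h`; in
        -- cross-multiplied form only 2 has to be cancelled.
        cross-double : ∀ {n q g h} → n + n ≈ g * g → q + q ≈ g * h → n * h ≈ g * q
        cross-double {n} {q} {g} {h} n+n≈ q+q≈ = *-cancelˡ 2# _ _ 2≉0 (begin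
          2# * (n * h)  ≈⟨ solve 2 (λ n h → (con 1 :+ con 1) :* (n :* h) := (n :+ n) :* h) ≈-refl n h ⟩
          (n + n) * h   ≈⟨ *-congʳ n+n≈ ⟩
          g * g * h     ≈⟨ *-assoc g g h ⟩
          g * (g * h)   ≈⟨ *-congˡ q+q≈ ⟨
          g * (q + q)   ≈⟨ solve 2 (λ g q → g :* (q :+ q) := (con 1 :+ con 1) :* (g :* q)) ≈-refl g q ⟩
          2# * (g * q)  ∎)

      X≉0 : ¬ b + b + P ≈ 0#
      X≉0 X≈0 = double≉0 q₁≉0 (trans 4[1-y]t≈PX (trans (*-congˡ X≈0) (zeroʳ P)))

      W≉0 : ¬ b + b + P + P + Q ≈ 0#
      W≉0 W≈0 = double≉0 q₂≉0 (trans 4yt≈QW (trans (*-congˡ W≈0) (zeroʳ Q)))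

      N₁-cross : N₁ * (b + b + P) ≈ P * (2# * (1# - y) * t)
      N₁-cross = cross-double 2N₁≈P² 4[1-y]t≈PX

      N₂-cross : N₂ * (b + b + P + P + Q) ≈ Q * (2# * y * t)
      N₂-cross = cross-double 2N₂≈Q² 4yt≈QW

-- The equations solved by `u` and `v`.

module Parametrised {c ℓ} (F : IntegralDomain c ℓ) where
  open IntegralDomain F renaming (refl to ≈-refl)
  open Solver commutativeSemiring using (solve; _:=_; _:+_; _:*_; con)
  open SetoidReasoning setoid

  module Solution {y t b P Q u v : Carrier}
    (b+b+P+Q≈2 : b + b + P + Q ≈ 1# + 1#)
    (t+t≈P+Q : t + t ≈ P + Q)
    (4yt≈QW : (1# + 1#) * y * t + (1# + 1#) * y * t ≈ Q * (b + b + P + P + Q))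
    (X≉0 : ¬ b + b + P ≈ 0#) (W≉0 : ¬ b + b + P + P + Q ≈ 0#)
    (uX≈P : u * (b + b + P) ≈ P) (vW≈Q : v * (b + b + P + P + Q) ≈ Q)
    where
    private
      X W G : Carrier
      X = b + b + P
      W = b + b + P + P + Q
      G = (b + P) + (b + P)

      -- Since `u` is `P / X` and `v` is `Q / W`, clearing denominators in `1 + u v` and in `u + v`
      -- produces the same factor `G`, which is `2 ρ` in the application. The cofactors are 2 and
      -- `2 t`.
      XW[1+uv] : X * W * (1# + u * v) ≈ G * (1# + 1#)
      XW[1+uv] = begin
        X * W * (1# + u * v)
          ≈⟨ solve 4 (λ x w u v → x :* w :* (con 1 :+ u :* v) := x :* w :+ (u :* x) :* (v :* w)) ≈-refl X W u v ⟩
        X * W + (u * X) * (v * W) ≈⟨ +-congˡ (*-cong uX≈P vW≈Q) ⟩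
        X * W + P * Q
          ≈⟨ solve 3 (λ b p q → (b :+ b :+ p) :* (b :+ b :+ p :+ p :+ q) :+ p :* q :=
               ((b :+ p) :+ (b :+ p)) :* (b :+ b :+ p :+ q)) ≈-refl b P Q ⟩
        G * (b + b + P + Q)       ≈⟨ *-congˡ b+b+P+Q≈2 ⟩
        G * (1# + 1#)             ∎

      XW[u+v] : X * W * (u + v) ≈ G * (t + t)
      XW[u+v] = begin
        X * W * (u + v)
          ≈⟨ solve 4 (λ x w u v → x :* w :* (u :+ v) := (u :* x) :* w :+ x :* (v :* w)) ≈-refl X W u v ⟩
        (u * X) * W + X * (v * W) ≈⟨ +-cong (*-congʳ uX≈P) (*-congˡ vW≈Q) ⟩
        P * W + X * Q
          ≈⟨ solve 3 (λ b p q → p :* (b :+ b :+ p :+ p :+ q) :+ (b :+ b :+ p) :* q :=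
               ((b :+ p) :+ (b :+ p)) :* (p :+ q)) ≈-refl b P Q ⟩
        G * (P + Q)               ≈⟨ *-congˡ t+t≈P+Q ⟨
        G * (t + t)               ∎

      XW≉0 : ¬ X * W ≈ 0#
      XW≉0 = *-≉0 X≉0 W≉0

    t[1+uv]≈u+v : t * (1# + u * v) ≈ u + v
    t[1+uv]≈u+v = *-cancelˡ (X * W) _ _ XW≉0 (begin
      X * W * (t * (1# + u * v))
        ≈⟨ solve 3 (λ x t w → x :* (t :* w) := t :* (x :* w)) ≈-refl (X * W) t (1# + u * v) ⟩
      t * (X * W * (1# + u * v)) ≈⟨ *-congˡ XW[1+uv] ⟩
      t * (G * (1# + 1#))
        ≈⟨ solve 2 (λ t g → t :* (g :* (con 1 :+ con 1)) := g :* (t :+ t)) ≈-refl t G ⟩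
      G * (t + t)                ≈⟨ XW[u+v] ⟨
      X * W * (u + v)            ∎)

    -- Multiplied by `(X W)²`, the left side becomes `G²` times `4 y t`, and the right side `G² Q W`
    -- because `(1 + u) X = X + P = G` and `v W = Q`.
    y[u+v][1+uv]≈[1+u]²v : y * ((u + v) * (1# + u * v)) ≈ (1# + u) ^ 2 * v
    y[u+v][1+uv]≈[1+u]²v = *-cancelˡ (X * W * (X * W)) _ _ (*-≉0 XW≉0 XW≉0) (begin
      X * W * (X * W) * (y * ((u + v) * (1# + u * v)))
        ≈⟨ solve 4 (λ x y w z → x :* x :* (y :* (w :* z)) := y :* ((x :* w) :* (x :* z)))
             ≈-refl (X * W) y (u + v) (1# + u * v) ⟩
      y * ((X * W * (u + v)) * (X * W * (1# + u * v))) ≈⟨ *-congˡ (*-cong XW[u+v] XW[1+uv]) ⟩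
      y * ((G * (t + t)) * (G * (1# + 1#)))
        ≈⟨ solve 3 (λ y g t → let two = con 1 :+ con 1 in
             y :* ((g :* (t :+ t)) :* (g :* two)) := g :* g :* (two :* y :* t :+ two :* y :* t)) ≈-refl y G t ⟩
      G * G * ((1# + 1#) * y * t + (1# + 1#) * y * t)  ≈⟨ *-congˡ 4yt≈QW ⟩
      G * G * (Q * W)
        ≈⟨ *-congʳ (*-cong X+P≈G X+P≈G) ⟨
      (X + P) * (X + P) * (Q * W)
        ≈⟨ *-cong (*-cong (+-congˡ uX≈P) (+-congˡ uX≈P)) (*-congʳ vW≈Q) ⟨
      (X + u * X) * (X + u * X) * (v * W * W)
        ≈⟨ solve 4 (λ x u v w → (x :+ u :* x) :* (x :+ u :* x) :* (v :* w :* w) :=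
             x :* w :* (x :* w) :* ((con 1 :+ u) :* ((con 1 :+ u) :* con 1) :* v)) ≈-refl X u v W ⟩
      X * W * (X * W) * ((1# + u) ^ 2 * v) ∎)
      where
      X+P≈G : X + P ≈ G
      X+P≈G = solve 2 (λ b p → b :+ b :+ p :+ p := (b :+ p) :+ (b :+ p)) ≈-refl b P

-- Quotients in a field, and the embedding of a domain into its fraction field.

module FieldProperties {c ℓ} (F : Field c ℓ) where
  open Field F
  open SetoidReasoning setoid

  /-* : ∀ x {z} (z≉0 : ¬ z ≈ 0#) → x / z [ z≉0 ] * z ≈ x
  /-* x {z} z≉0 = begin
    x * inverse z z≉0 * z    ≈⟨ *-assoc _ _ _ ⟩
    x * (inverse z z≉0 * z)  ≈⟨ *-congˡ (trans (*-comm _ _) (*-inverse z z≉0)) ⟩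
    x * 1#                   ≈⟨ *-identityʳ x ⟩
    x                        ∎

  /-unique : ∀ {x z w} (z≉0 : ¬ z ≈ 0#) → x ≈ z * w → w ≈ x / z [ z≉0 ]
  /-unique {x} {z} {w} z≉0 x≈zw = *-cancelˡ z _ _ z≉0
    (trans (sym x≈zw) (trans (sym (/-* x z≉0)) (*-comm _ _)))

  /-cross : ∀ {n z g h} (z≉0 : ¬ z ≈ 0#) → n * h ≈ g * z → n / z [ z≉0 ] * h ≈ g
  /-cross {n} {z} {g} {h} z≉0 nh≈gz = *-cancelˡ z _ _ z≉0 (begin
    z * (n / z [ z≉0 ] * h)  ≈⟨ *-assoc _ _ _ ⟨
    z * (n / z [ z≉0 ]) * h  ≈⟨ *-congʳ (trans (*-comm _ _) (/-* n z≉0)) ⟩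
    n * h                    ≈⟨ trans nh≈gz (*-comm g z) ⟩
    z * g                    ∎)

module Embedding {c ℓ} (R : IntegralDomain c ℓ) where
  private
    module R = IntegralDomain R
  open FractionField R using (ι; ι-injective; crossMultiplied; fractionField)
  open Field fractionField renaming (refl to ≈-refl)
  open Solver R.commutativeSemiring using (solve; _:=_; _:+_; _:*_; con)

  ι-cong : ∀ {x z} → x R.≈ z → ι x ≈ ι z
  ι-cong x≈z = crossMultiplied (R.*-congʳ x≈z)

  ι-+ : ∀ x z → ι (x R.+ z) ≈ ι x + ι z
  ι-+ x z = crossMultiplied (solve 2 (λ x z →
    (x :+ z) :* (con 1 :* con 1) := (x :* con 1 :+ z :* con 1) :* con 1) R.refl x z)

  ι-* : ∀ x z → ι (x R.* z) ≈ ι x * ι z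
  ι-* x z = crossMultiplied (solve 2 (λ x z →
    (x :* z) :* (con 1 :* con 1) := (x :* z) :* con 1) R.refl x z)

  ι-^ : ∀ x n → ι (x R.^ n) ≈ ι x ^ n
  ι-^ x zero    = ≈-refl
  ι-^ x (suc n) = trans (ι-* x (x R.^ n)) (*-congˡ (ι-^ x n))

  ι-≉0 : ∀ {x} → ¬ x R.≈ R.0# → ¬ ι x ≈ 0#
  ι-≉0 x≉0 ιx≈0 = x≉0 (ι-injective ιx≈0)

  ι-P⟨lpk,des⟩ : ∀ n x z → ι (P⟨lpk,des⟩ R.commutativeRing n x z) ≈ P⟨lpk,des⟩ commutativeRing n (ι x) (ι z)
  ι-P⟨lpk,des⟩ n x z = go (𝔖 n)
    where
    go : ∀ πs → ι (foldr R._+_ R.0# (map (λ π → x R.^ lpk π R.* z R.^ des π) πs))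
              ≈ foldr _+_ 0# (map (λ π → ι x ^ lpk π * ι z ^ des π) πs)
    go []       = ≈-refl
    go (π ∷ πs) = trans (ι-+ _ _) (+-cong
      (trans (ι-* _ _) (*-cong (ι-^ x (lpk π)) (ι-^ z (des π)))) (go πs))

-- The converse identity.

module Inversion {c ℓ} (R : IntegralDomain c ℓ) where
  private
    module R = IntegralDomain R
  open FractionField R using (ι; fractionField)
  open Field fractionField
  open FieldProperties fractionField
  open Embedding R

  module _ (y t ρ : R.Carrier)
    (ρ-square : ρ R.* ρ R.≈ (R.1# R.+ t) R.^ 2 R.- (R.1# R.+ R.1#) R.* (R.1# R.+ R.1#) R.* y R.* t)
    (q₁≉0 : ¬ (R.1# R.+ R.1#) R.* (R.1# R.- y) R.* t R.≈ R.0#)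
    (q₂≉0 : ¬ (R.1# R.+ R.1#) R.* y R.* t R.≈ R.0#)
    (ιq₁≉0 : ¬ ι ((R.1# R.+ R.1#) R.* (R.1# R.- y) R.* t) ≈ 0#)
    (ιq₂≉0 : ¬ ι ((R.1# R.+ R.1#) R.* y R.* t) ≈ 0#)
    where
    private
      module Rad = Radical.Root R y t ρ ρ-square
      open Rad using (b; P; Q)

      ι-X : ι (b R.+ b R.+ P) ≈ ι b + ι b + ι P
      ι-X = trans (ι-+ _ P) (+-congʳ (ι-+ b b))
      ι-W : ι (b R.+ b R.+ P R.+ P R.+ Q) ≈ ι b + ι b + ι P + ι P + ι Q
      ι-W = trans (ι-+ _ Q) (+-congʳ (trans (ι-+ _ P) (+-congʳ ι-X)))
      ι-2yt : ι ((R.1# R.+ R.1#) R.* y R.* t) ≈ (1# + 1#) * ι y * ι t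
      ι-2yt = trans (ι-* _ t) (*-congʳ (trans (ι-* _ y) (*-congʳ (ι-+ R.1# R.1#))))

    -- The nonvanishing proofs of the denominators are parameters, so that the instance used at the
    -- end is literally the `u` and `v` of `Substitution`.
    u v : Carrier
    u = ι (R.1# R.+ t R.^ 2 R.- (R.1# R.+ R.1#) R.* y R.* t R.- (R.1# R.- t) R.* ρ)
          / ι ((R.1# R.+ R.1#) R.* (R.1# R.- y) R.* t) [ ιq₁≉0 ]
    v = ι ((R.1# R.+ t) R.^ 2 R.- (R.1# R.+ R.1#) R.* y R.* t R.- (R.1# R.+ t) R.* ρ)
          / ι ((R.1# R.+ R.1#) R.* y R.* t) [ ιq₂≉0 ]

    private
      -- The relations among `b`, `P` and `Q` hold in the domain and are carried along `ι`; the last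
      -- two arguments reduce `u` to `P / X` and `v` to `Q / W`.
      module Identities = Parametrised.Solution integralDomain {ι y} {ι t} {ι b} {ι P} {ι Q} {u} {v}
        (trans (sym (trans (ι-+ _ Q) (+-congʳ ι-X)))
          (trans (ι-cong Rad.b+b+P+Q≈2) (ι-+ R.1# R.1#)))
        (trans (sym (ι-+ t t)) (trans (ι-cong Rad.t+t≈P+Q) (ι-+ P Q)))
        (trans (sym (trans (ι-+ _ _) (+-cong ι-2yt ι-2yt)))
          (trans (ι-cong Rad.4yt≈QW) (trans (ι-* Q _) (*-congˡ ι-W))))
        (λ X≈0 → ι-≉0 (Rad.X≉0 q₁≉0 q₂≉0) (trans ι-X X≈0))
        (λ W≈0 → ι-≉0 (Rad.W≉0 q₁≉0 q₂≉0) (trans ι-W W≈0))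
        (trans (*-congˡ (sym ι-X)) (/-cross ιq₁≉0
          (trans (sym (ι-* _ _)) (trans (ι-cong (Rad.N₁-cross q₁≉0 q₂≉0)) (ι-* _ _)))))
        (trans (*-congˡ (sym ι-W)) (/-cross ιq₂≉0
          (trans (sym (ι-* _ _)) (trans (ι-cong (Rad.N₂-cross q₁≉0 q₂≉0)) (ι-* _ _)))))

    -- The roles are exchanged: `u` and `v` are the arguments of `B`, while `ι y` and `ι t` satisfy
    -- the equations for `y′` and `t′`. Division by the power finishes.
    P⟨lpk,des⟩≈B : ∀ n (1+uv^n≉0 : ¬ (1# + u * v) ^ n ≈ 0#) →
      ι (P⟨lpk,des⟩ R.commutativeRing n y t) ≈ B commutativeRing n u v / (1# + u * v) ^ n [ 1+uv^n≉0 ]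
    P⟨lpk,des⟩≈B n 1+uv^n≉0 = trans (ι-P⟨lpk,des⟩ n y t) (/-unique 1+uv^n≉0
      (B≈P⟨lpk,des⟩ commutativeRing u v (ι y) (ι t)
        Identities.t[1+uv]≈u+v Identities.y[u+v][1+uv]≈[1+u]²v n))

theorem4p10 : ((n : ℕ) →
    let open RationalFunctions in
    B commutativeRing n y t
    ≈ (1# + y * t) ^ n
    * P⟨lpk,des⟩ commutativeRing n
    (((1# + y) ^ 2 * t) / ((y + t) * (1# + y * t)) [ [y+t][1+yt]≉0 ])
    ((y + t) / (1# + y * t) [ 1+yt≉0 ]))
    ×
    ((n : ℕ) →
    let open QuotientsOfPowerSeries
        open Frac-ℚ[y]⟦t⟧ using (ι)
        open Substitution in
    ι (P⟨lpk,des⟩ PowerSeriesInT.commutativeRing n PowerSeriesInT.y PowerSeriesInT.t)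
    ≈ B commutativeRing n u v / (1# + u * v) ^ n [ ^-≉0 1+uv≉0 n ])
theorem4p10 =
  -- Each quotient times its denominator gives one of the two cross-multiplied equations.
  (λ n → B≈P⟨lpk,des⟩ R.commutativeRing R.y R.t _ _ (/-* _ R.1+yt≉0) (/-* _ R.[y+t][1+yt]≉0) n) ,
  (λ n → Inversion.P⟨lpk,des⟩≈B ℚ[y]⟦t⟧.integralDomain S.y S.t S.ρ S.ρ-square S.2[1-y]t≉0 S.2yt≉0
    (Substitution.ι-≉0 S.2[1-y]t≉0) (Substitution.ι-≉0 S.2yt≉0) n
    (QuotientsOfPowerSeries.^-≉0 Substitution.1+uv≉0 n))
  where
  module R = RationalFunctions
  module S = PowerSeriesInT
  open FieldProperties ℚ⟨y,t⟩.fractionField
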